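{- Let $R$ be a dedekind type domain, let $\mathit{M}(R)$ be the monoid generated by the maximal ideals of $R$, let $\mathcal{I}\in\mathit{M}(R)$, and let $k\ge2$. Let $\mathcal{F}$ be a finite set of maximal ideals containing every maximal ideal that contains $\mathcal{I}$, and let $\Sigma:\mathit{M}(\mathcal{F})\to R$ be a nowhere zero map satisfying conditions (1)–(4) below. Then every element of $\mathbb{PF}^k_{\mathcal{I}}$ can be written as $[\Sigma(\mathcal{J}_0)v_0:\Sigma(\mathcal{J}_1)v_1:\dots:\Sigma(\mathcal{J}_k)v_k]$ where $\mathcal{J}_0,\dots,\mathcal{J}_k\in\mathit{M}(\mathcal{F})$ with $\mathcal{J}_i\supseteq\mathcal{I}$ and $\sum_i\mathcal{J}_i=R$ (hence $\sum_i(\Sigma(\mathcal{J}_i))=R$), and $v_0,\dots,v_k\in R\setminus\bigcup_{\mathcal{M}\in\mathcal{F}}\mathcal{M}$ with $\sum_{i=0}^k(\Sigma(\mathcal{J}_i)v_i)=R$; that is, $\mathbb{PF}^k_{\mathcal{I}}$ equals the set of all such classes.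
   Context: Dedekind type domain: a commutative ring $R$ with unity which is a field, or in which every maximal ideal $\mathcal{M}$ satisfies $\mathcal{M}^i\neq\mathcal{M}^{i+1}$ ($i\ge0$), $\bigcap_{i\ge0}\mathcal{M}^i=(0)$, $\dim_{R/\mathcal{M}}\mathcal{M}^i/\mathcal{M}^{i+1}=1$ ($i\ge0$), and every nonzero element lies in only finitely many maximal ideals. $\mathit{M}(\mathcal{F})$ ($\mathit{M}(R)$) is the set of finite products of maximal ideals in $\mathcal{F}$ (resp. all maximal ideals), $R$ being the empty product; $\mathit{M}(\mathcal{F})^*=\mathit{M}(\mathcal{F})\setminus\{R\}$; $\mathcal{S}_{\mathcal{J}}=\mathcal{J}\setminus\bigcup_{\mathcal{K}\in\mathit{M}(\mathcal{F})^*}\mathcal{J}\mathcal{K}$. Conditions on $\Sigma$: (1) $\Sigma(R)=1$; (2) $\Sigma(\mathcal{J})\in\mathcal{S}_{\mathcal{J}}$; (3) $\Sigma(\mathcal{J}\mathcal{K})=\Sigma(\mathcal{J})\Sigma(\mathcal{K})$ for comaximal $\mathcal{J},\mathcal{K}$; (4) $\sum\mathcal{J}_i=R\Rightarrow\sum(\Sigma(\mathcal{J}_i))=R$ (such $\Sigma$ exists). Projective space: for an ideal $\mathcal{I}\in\mathit{M}(R)$, unital tuples $(a_0,\dots,a_k)$ (i.e. $(a_0,\dots,a_k)=R$) are identified when $a_ib_j-a_jb_i\in\mathcal{I}$ for all $i<j$; $[a_0:\dots:a_k]$ is the class and $\mathbb{PF}^k_{\mathcal{I}}$ the set of classes. 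-}

module Defs where

open import Level using (Level; _⊔_) renaming (suc to lsuc)
open import Algebra.Bundles using (CommutativeRing)
open import Data.Nat using (ℕ; zero; suc)
open import Data.Fin using (Fin; zero; suc) renaming (_<_ to _<ᶠ_)
open import Data.Product using (Σ; ∃; ∃-syntax; _×_; _,_)
open import Data.Sum using (_⊎_)
open import Data.Unit.Polymorphic using (⊤)
open import Relation.Nullary using (¬_)

module RingDefs {c ℓ : Level} (R : CommutativeRing c ℓ) where

  open CommutativeRing R using (Carrier; _≈_; _+_; _*_; _-_; 0#; 1#)

  Subset : Set (c ⊔ lsuc (c ⊔ ℓ))
  Subset = Carrier → Set (c ⊔ ℓ)

  _∈_ : Carrier → Subset → Set (c ⊔ ℓ)
  x ∈ P = P x

  _∉_ : Carrier → Subset → Set (c ⊔ ℓ)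
  x ∉ P = ¬ (P x)

  _⊆_ : Subset → Subset → Set (c ⊔ ℓ)
  P ⊆ Q = ∀ x → x ∈ P → x ∈ Q

  _≐_ : Subset → Subset → Set (c ⊔ ℓ)
  P ≐ Q = (P ⊆ Q) × (Q ⊆ P)

  record IsIdeal (P : Subset) : Set (c ⊔ ℓ) where
    field
      resp   : ∀ {x y} → x ≈ y → x ∈ P → y ∈ P
      0∈     : 0# ∈ P
      +-clos : ∀ {x y} → x ∈ P → y ∈ P → (x + y) ∈ P
      *-clos : ∀ r {x} → x ∈ P → (r * x) ∈ P

  whole : Subset
  whole _ = ⊤

  sumF : ∀ {n} → (Fin n → Carrier) → Carrier
  sumF {zero}  a = 0#
  sumF {suc n} a = a zero + sumF (λ i → a (suc i))

  _·_ : Subset → Subset → Subset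
  (I · J) x = ∃[ n ] Σ (Fin n → Carrier) λ a → Σ (Fin n → Carrier) λ b →
                (∀ i → a i ∈ I) × (∀ i → b i ∈ J) × (x ≈ sumF (λ i → a i * b i))

  sumIdeals : ∀ {n} → (Fin n → Subset) → Subset
  sumIdeals {n} J x = Σ (Fin n → Carrier) λ a → (∀ i → a i ∈ J i) × (x ≈ sumF a)

  gen : ∀ {n} → (Fin n → Carrier) → Subset
  gen {n} a x = Σ (Fin n → Carrier) λ r → x ≈ sumF (λ i → r i * a i)

  Unital : ∀ {n} → (Fin n → Carrier) → Set (c ⊔ ℓ)
  Unital a = gen a ≐ whole

  _^ᴵ_ : Subset → ℕ → Subset
  I ^ᴵ zero  = whole
  I ^ᴵ suc n = I · (I ^ᴵ n)

  record IsMaximal (M : Subset) : Set (lsuc (c ⊔ ℓ)) where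
    field
      isIdeal : IsIdeal M
      proper  : 1# ∉ M
      maximal : ∀ (J : Subset) → IsIdeal J → M ⊆ J → (J ⊆ M) ⊎ (J ≐ whole)

  record MaxIdeal : Set (lsuc (c ⊔ ℓ)) where
    field
      carrier   : Subset
      isMaximal : IsMaximal carrier
  open MaxIdeal public using (carrier)

  IsField : Set (c ⊔ ℓ)
  IsField = (¬ (1# ≈ 0#)) × (∀ x → ¬ (x ≈ 0#) → ∃[ y ] (x * y ≈ 1#))

  -- dim_{R/M} (M^i / M^(i+1)) = 1 : there is a nonzero class [a] (a ∈ M^i, a ∉ M^(i+1))
  -- spanning M^i / M^(i+1) over R/M.
  Dim1 : Subset → ℕ → Set (c ⊔ ℓ)
  Dim1 M i = ∃[ a ] (a ∈ (M ^ᴵ i)) × (a ∉ (M ^ᴵ suc i)) ×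
               (∀ x → x ∈ (M ^ᴵ i) → ∃[ r ] ((x - r * a) ∈ (M ^ᴵ suc i)))

  IsDedekindType : Set (lsuc (c ⊔ ℓ))
  IsDedekindType =
    IsField ⊎
    ( (∀ (M : MaxIdeal) →
         (∀ i → ¬ ((carrier M ^ᴵ i) ≐ (carrier M ^ᴵ suc i)))
       × (∀ x → (∀ i → x ∈ (carrier M ^ᴵ i)) → x ≈ 0#)
       × (∀ i → Dim1 (carrier M) i))
    × (∀ x → ¬ (x ≈ 0#) →
         ∃[ n ] Σ (Fin n → MaxIdeal) λ L →
           ∀ (M : MaxIdeal) → x ∈ carrier M → ∃[ j ] (carrier M ≐ carrier (L j))) )

  prodList : ∀ {n} → (Fin n → MaxIdeal) → Subset
  prodList {zero}  L = whole
  prodList {suc n} L = carrier (L zero) · prodList (λ i → L (suc i))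

  InMR : Subset → Set (lsuc (c ⊔ ℓ))
  InMR I = ∃[ n ] Σ (Fin n → MaxIdeal) λ L → I ≐ prodList L

  -- Elements of M(F), for F = {F_0,...,F_{m-1}}, are represented by exponent
  -- vectors e : Fin m → ℕ, standing for the ideal  Π_j F_j ^ (e j).
  Exps : ℕ → Set
  Exps m = Fin m → ℕ

  prodF : ∀ {m} → (Fin m → MaxIdeal) → Exps m → Subset
  prodF {zero}  F e = whole
  prodF {suc m} F e = (carrier (F zero) ^ᴵ e zero) · prodF (λ j → F (suc j)) (λ j → e (suc j))

  e₀ : ∀ {m} → Exps m
  e₀ _ = 0

  S : ∀ {m} → (Fin m → MaxIdeal) → Exps m → Subset
  S F e x = (x ∈ prodF F e) ×
            (∀ (e' : Exps _) → ¬ (prodF F e' ≐ whole) → x ∉ (prodF F e · prodF F e'))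

  record IsSigma {m} (F : Fin m → MaxIdeal) (σ : Exps m → Carrier) : Set (lsuc (c ⊔ ℓ)) where
    field
      welldef    : ∀ e e' → prodF F e ≐ prodF F e' → σ e ≈ σ e'
      nowhereZero : ∀ e → ¬ (σ e ≈ 0#)
      cond1 : σ e₀ ≈ 1#
      cond2 : ∀ e → σ e ∈ S F e
      cond3 : ∀ e e' e'' → (sumIdeals {2} (λ { zero → prodF F e ; (suc _) → prodF F e' }) ≐ whole) →
                prodF F e'' ≐ (prodF F e · prodF F e') → σ e'' ≈ σ e * σ e'
      cond4 : ∀ n (J : Fin n → Exps m) → sumIdeals (λ i → prodF F (J i)) ≐ whole →
                Unital (λ i → σ (J i))

  -- the relation identifying unital tuples in PF^k_I
  Rel : Subset → ∀ {n} → (Fin n → Carrier) → (Fin n → Carrier) → Set (c ⊔ ℓ)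
  Rel I a b = ∀ i j → i <ᶠ j → (a i * b j - a j * b i) ∈ I

{-# OPTIONS --safe #-}

-- Let G₁, …, G_t be the distinct members of F, let n_l be the exponent of G_l in I, and let
-- J_i carry the exponents e_{il} = min (ord_l a_i, n_l).  At each l some a_p lies outside G_l;
-- after scaling the row a there, σ(J_i) w_i ≡ λ a_i mod G_l^{n_l} has a solution with w_p = 1
-- and every w_i outside G_l.  Rows containing a 1 are obtained from (1, 0, …, 0) by
-- transvections, so these solutions lift to a row v that is unimodular over R, even with
-- v ≡ w modulo a multiple y_l of all the σ(G_l^{e_{il}}).  The row b_i = σ(J_i) v_i is
-- then unimodular modulo each y_l, because b_p is a unit there; and the ideal (b) contains
-- the product of the y_l, because v is unimodular and each σ(J_i) divides that product.
-- Hence (b) = R.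
--
-- Testing unimodularity at the maximal ideals is not an option here: without Zorn's lemma a
-- proper ideal need not lie in a maximal one.
module Submission where

open import Defs
open import Level using (Level; _⊔_) renaming (suc to lsuc)
open import Algebra.Bundles using (CommutativeRing; CommutativeMonoid)
open import Data.Nat using (ℕ; zero; suc; _≥_; _≤_; z≤n; s≤s) renaming (_+_ to _+ℕ_)
open import Data.Fin using (Fin; zero; suc)
open import Data.Product using (Σ; ∃-syntax; _×_; _,_; proj₁; proj₂)
open import Data.Sum using (_⊎_; inj₁; inj₂; [_,_]′)
open import Data.Unit.Polymorphic using (tt)
open import Data.Empty using (⊥-elim)
open import Data.Vec.Functional using (_∷_)
open import Function using (_∘_)
open import Relation.Nullary using (¬_; Dec; yes; no)
open import Relation.Binary.Bundles using (Setoid)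
open import Relation.Binary.PropositionalEquality as ≡ using (_≡_; _≢_)
import Data.Nat.Properties as ℕₚ
import Data.Fin.Properties as Finₚ
import Algebra.Properties.Ring as RingProperties
import Algebra.Properties.CommutativeSemigroup as CommutativeSemigroupProperties
import Relation.Binary.Reasoning.Setoid as SetoidReasoning

module Ideals {c ℓ : Level} (R : CommutativeRing c ℓ) where

  open CommutativeRing R hiding (zero)
  open RingDefs R
  open RingProperties ring
  open CommutativeSemigroupProperties +-commutativeSemigroup
    using () renaming (interchange to +-interchange)
  open CommutativeSemigroupProperties *-commutativeSemigroup
    using () renaming (interchange to *-interchange; x∙yz≈z∙yx to x*yz≈z*yx; x∙yz≈yx∙z to x*yz≈yx*z)

  -- Ideals bundled with their closure proofs.

  record Ideal : Set (lsuc (c ⊔ ℓ)) where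
    constructor ideal
    field
      ⟦_⟧     : Subset
      isIdeal : IsIdeal ⟦_⟧
    open IsIdeal isIdeal public

  open Ideal using (⟦_⟧)

  neg-closed : ∀ (A : Ideal) {x} → ⟦ A ⟧ x → ⟦ A ⟧ (- x)
  neg-closed A {x} x∈ = Ideal.resp A (-1*x≈-x x) (Ideal.*-clos A (- 1#) x∈)

  *-closʳ : ∀ (A : Ideal) {x} r → ⟦ A ⟧ x → ⟦ A ⟧ (x * r)
  *-closʳ A {x} r x∈ = Ideal.resp A (*-comm r x) (Ideal.*-clos A r x∈)

  1∈⇒whole : ∀ (A : Ideal) → ⟦ A ⟧ 1# → ⟦ A ⟧ ≐ whole
  1∈⇒whole A 1∈ = (λ _ _ → tt) , λ x _ → Ideal.resp A (*-identityʳ x) (Ideal.*-clos A x 1∈)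

  -- Congruence modulo an ideal

  -- A record rather than a bare membership, so that both elements and the ideal can be inferred
  -- from the type of a congruence.
  record _≡_mod_ (x y : Carrier) (A : Ideal) : Set (c ⊔ ℓ) where
    constructor mk
    field diff : ⟦ A ⟧ (x - y)
  open _≡_mod_
  infix 4 _≡_mod_

  ≈⇒mod : ∀ {A x y} → x ≈ y → x ≡ y mod A
  ≈⇒mod {A} x≈y = mk (Ideal.resp A (sym (x≈y⇒x∙y⁻¹≈ε x≈y)) (Ideal.0∈ A))

  mod-sym : ∀ {A x y} → x ≡ y mod A → y ≡ x mod A
  mod-sym {A} {x} {y} (mk d) = mk (Ideal.resp A (⁻¹-anti-homo-// x y) (neg-closed A d))

  mod-trans : ∀ {A x y z} → x ≡ y mod A → y ≡ z mod A → x ≡ z mod A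
  mod-trans {A} {x} {y} {z} (mk d) (mk d′) = mk (Ideal.resp A eq (Ideal.+-clos A d d′))
    where
    eq : (x - y) + (y - z) ≈ x - z
    eq = begin
      (x - y) + (y - z)    ≈⟨ +-assoc x (- y) (y - z) ⟩
      x + (- y + (y - z))  ≈⟨ +-congˡ (sym (+-assoc (- y) y (- z))) ⟩
      x + ((- y + y) - z)  ≈⟨ +-congˡ (+-congʳ (-‿inverseˡ y)) ⟩
      x + (0# - z)         ≈⟨ +-congˡ (+-identityˡ (- z)) ⟩
      x - z                ∎
      where open SetoidReasoning setoid

  modSetoid : Ideal → Setoid c (c ⊔ ℓ)
  modSetoid A = record
    { Carrier = Carrier
    ; _≈_ = λ x y → x ≡ y mod A
    ; isEquivalence = record { refl = ≈⇒mod refl ; sym = mod-sym ; trans = mod-trans }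
    }

  module ModReasoning (A : Ideal) = SetoidReasoning (modSetoid A)

  mod-+ : ∀ {A x y u v} → x ≡ y mod A → u ≡ v mod A → x + u ≡ y + v mod A
  mod-+ {A} {x} {y} {u} {v} (mk d) (mk d′) = mk (Ideal.resp A eq (Ideal.+-clos A d d′))
    where
    eq : (x - y) + (u - v) ≈ (x + u) - (y + v)
    eq = trans (+-interchange x (- y) u (- v)) (+-congˡ (-‿+-comm y v))

  mod-*ˡ : ∀ {A x y} r → x ≡ y mod A → r * x ≡ r * y mod A
  mod-*ˡ {A} {x} {y} r (mk d) = mk (Ideal.resp A (x[y-z]≈xy-xz r x y) (Ideal.*-clos A r d))

  mod-*ʳ : ∀ {A x y} r → x ≡ y mod A → x * r ≡ y * r mod A
  mod-*ʳ {A} {x} {y} r e =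
    mod-trans (≈⇒mod (*-comm x r)) (mod-trans (mod-*ˡ r e) (≈⇒mod (*-comm r y)))

  mod-* : ∀ {A x y u v} → x ≡ y mod A → u ≡ v mod A → x * u ≡ y * v mod A
  mod-* {u = u} {v} e e′ = mod-trans (mod-*ʳ u e) (mod-*ˡ _ e′)

  mod-mono : ∀ {A B x y} → ⟦ A ⟧ ⊆ ⟦ B ⟧ → x ≡ y mod A → x ≡ y mod B
  mod-mono A⊆B (mk d) = mk (A⊆B _ d)

  mod-∈ : ∀ A {x y} → x ≡ y mod A → ⟦ A ⟧ y → ⟦ A ⟧ x
  mod-∈ A {x} {y} (mk d) y∈ = Ideal.resp A eq (Ideal.+-clos A d y∈)
    where
    eq : (x - y) + y ≈ x
    eq = trans (+-assoc x (- y) y) (trans (+-congˡ (-‿inverseˡ y)) (+-identityʳ x))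

  ∈⇒mod0 : ∀ {A x} → ⟦ A ⟧ x → x ≡ 0# mod A
  ∈⇒mod0 {A} {x} x∈ = mk (Ideal.resp A (sym (trans (+-congˡ -0#≈0#) (+-identityʳ x))) x∈)

  ∈⇒mod : ∀ {A x y} → ⟦ A ⟧ x → ⟦ A ⟧ y → x ≡ y mod A
  ∈⇒mod x∈ y∈ = mod-trans (∈⇒mod0 x∈) (mod-sym (∈⇒mod0 y∈))

  -- The monoid of ideals

  sumF-closed : ∀ (A : Ideal) {n} (a : Fin n → Carrier) → (∀ i → ⟦ A ⟧ (a i)) → ⟦ A ⟧ (sumF a)
  sumF-closed A {zero}  a a∈ = Ideal.0∈ A
  sumF-closed A {suc n} a a∈ =
    Ideal.+-clos A (a∈ zero) (sumF-closed A (a ∘ suc) (a∈ ∘ suc))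

  sumF-cong : ∀ {n} {a b : Fin n → Carrier} → (∀ i → a i ≈ b i) → sumF a ≈ sumF b
  sumF-cong {zero}  e = refl
  sumF-cong {suc n} e = +-cong (e zero) (sumF-cong (e ∘ suc))

  *-sumF : ∀ {n} r (a : Fin n → Carrier) → r * sumF a ≈ sumF (λ i → r * a i)
  *-sumF {zero}  r a = zeroʳ r
  *-sumF {suc n} r a = trans (distribˡ r _ _) (+-congˡ (*-sumF r (a ∘ suc)))

  sumF-+ : ∀ {n} (a b : Fin n → Carrier) → sumF a + sumF b ≈ sumF (λ i → a i + b i)
  sumF-+ {zero}  a b = +-identityʳ 0#
  sumF-+ {suc n} a b =
    trans (+-interchange _ _ _ _) (+-congˡ (sumF-+ (a ∘ suc) (b ∘ suc)))

  sumF-0 : ∀ n → sumF {n} (λ _ → 0#) ≈ 0#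
  sumF-0 zero    = refl
  sumF-0 (suc n) = trans (+-identityˡ _) (sumF-0 n)

  infixl 7 _⊗_
  _⊗_ : Ideal → Ideal → Ideal
  A ⊗ B = ideal (⟦ A ⟧ · ⟦ B ⟧) record
    { resp   = λ { x≈y (n , a , b , a∈ , b∈ , x≈) → n , a , b , a∈ , b∈ , trans (sym x≈y) x≈ }
    ; 0∈     = 0 , (λ ()) , (λ ()) , (λ ()) , (λ ()) , refl
    ; +-clos = λ { (n , a , b , a∈ , b∈ , x≈) y∈ → add-sum n a b a∈ b∈ x≈ y∈ }
    ; *-clos = λ { r (n , a , b , a∈ , b∈ , x≈) →
        n , (λ i → r * a i) , b , (λ i → Ideal.*-clos A r (a∈ i)) , b∈ ,
        trans (*-congˡ x≈) (trans (*-sumF r (λ i → a i * b i))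
                                  (sumF-cong λ i → sym (*-assoc r (a i) (b i)))) }
    }
    where
    add-sum : ∀ n a b → (∀ i → ⟦ A ⟧ (a i)) → (∀ i → ⟦ B ⟧ (b i)) → ∀ {x y} →
              x ≈ sumF {n} (λ i → a i * b i) →
              (⟦ A ⟧ · ⟦ B ⟧) y → (⟦ A ⟧ · ⟦ B ⟧) (x + y)
    add-sum zero a b a∈ b∈ x≈ (n , a′ , b′ , a′∈ , b′∈ , y≈) =
      n , a′ , b′ , a′∈ , b′∈ , trans (+-congʳ x≈) (trans (+-identityˡ _) y≈)
    add-sum (suc n) a b a∈ b∈ x≈ y∈
      with add-sum n (a ∘ suc) (b ∘ suc) (a∈ ∘ suc) (b∈ ∘ suc) refl y∈
    ... | n′ , a′ , b′ , a′∈ , b′∈ , z≈ =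
      suc n′ , (a zero ∷ a′) , (b zero ∷ b′)
      , (λ { zero → a∈ zero ; (suc i) → a′∈ i })
      , (λ { zero → b∈ zero ; (suc i) → b′∈ i })
      , trans (+-congʳ x≈) (trans (+-assoc _ _ _) (+-congˡ z≈))

  wholeᴵ : Ideal
  wholeᴵ = ideal whole record
    { resp = λ _ _ → tt ; 0∈ = tt ; +-clos = λ _ _ → tt ; *-clos = λ _ _ → tt }

  ⊗-intro : ∀ A B {x y} → ⟦ A ⟧ x → ⟦ B ⟧ y → ⟦ A ⊗ B ⟧ (x * y)
  ⊗-intro A B {x} {y} x∈ y∈ =
    1 , (λ _ → x) , (λ _ → y) , (λ _ → x∈) , (λ _ → y∈) , sym (+-identityʳ (x * y))

  ⊗-elim : ∀ A B K → (∀ {x y} → ⟦ A ⟧ x → ⟦ B ⟧ y → ⟦ K ⟧ (x * y)) → ⟦ A ⊗ B ⟧ ⊆ ⟦ K ⟧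
  ⊗-elim A B K f x (n , a , b , a∈ , b∈ , x≈) =
    Ideal.resp K (sym x≈) (sumF-closed K (λ i → a i * b i) (λ i → f (a∈ i) (b∈ i)))

  ⊗⊆ˡ : ∀ A B → ⟦ A ⊗ B ⟧ ⊆ ⟦ A ⟧
  ⊗⊆ˡ A B = ⊗-elim A B A (λ {_} {y} x∈ _ → *-closʳ A y x∈)

  ⊗⊆ʳ : ∀ A B → ⟦ A ⊗ B ⟧ ⊆ ⟦ B ⟧
  ⊗⊆ʳ A B = ⊗-elim A B B (λ {x} _ y∈ → Ideal.*-clos B x y∈)

  ⊗-mono : ∀ A A′ B B′ → ⟦ A ⟧ ⊆ ⟦ A′ ⟧ → ⟦ B ⟧ ⊆ ⟦ B′ ⟧ → ⟦ A ⊗ B ⟧ ⊆ ⟦ A′ ⊗ B′ ⟧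
  ⊗-mono A A′ B B′ f g =
    ⊗-elim A B (A′ ⊗ B′) (λ x∈ y∈ → ⊗-intro A′ B′ (f _ x∈) (g _ y∈))

  ⊗-comm-⊆ : ∀ A B → ⟦ A ⊗ B ⟧ ⊆ ⟦ B ⊗ A ⟧
  ⊗-comm-⊆ A B = ⊗-elim A B (B ⊗ A)
    (λ {x} {y} x∈ y∈ → Ideal.resp (B ⊗ A) (*-comm y x) (⊗-intro B A y∈ x∈))

  -- The colon ideal (A : r). It turns a claim about all multiples `x * r` into an inclusion of
  -- ideals, to which `⊗-elim` and `gen-elim` apply.
  colon : Ideal → Carrier → Ideal
  colon A r = ideal (λ x → ⟦ A ⟧ (x * r)) record
    { resp   = λ x≈y → Ideal.resp A (*-congʳ x≈y)
    ; 0∈     = Ideal.resp A (sym (zeroˡ r)) (Ideal.0∈ A)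
    ; +-clos = λ x∈ y∈ → Ideal.resp A (sym (distribʳ r _ _)) (Ideal.+-clos A x∈ y∈)
    ; *-clos = λ s x∈ → Ideal.resp A (sym (*-assoc s _ r)) (Ideal.*-clos A s x∈)
    }

  ⊗-assoc-⊆ : ∀ A B C → ⟦ (A ⊗ B) ⊗ C ⟧ ⊆ ⟦ A ⊗ (B ⊗ C) ⟧
  ⊗-assoc-⊆ A B C = ⊗-elim (A ⊗ B) C (A ⊗ (B ⊗ C)) λ {x} {z} x∈ z∈ →
    ⊗-elim A B (colon (A ⊗ (B ⊗ C)) z)
      (λ {u} {v} u∈ v∈ → Ideal.resp (A ⊗ (B ⊗ C)) (sym (*-assoc u v z))
        (⊗-intro A (B ⊗ C) u∈ (⊗-intro B C v∈ z∈)))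
      x x∈

  record _≃_ (A B : Ideal) : Set (c ⊔ ℓ) where
    constructor mk≃
    field
      ⊆-to   : ⟦ A ⟧ ⊆ ⟦ B ⟧
      ⊆-from : ⟦ B ⟧ ⊆ ⟦ A ⟧
    ≃⇒≐ : ⟦ A ⟧ ≐ ⟦ B ⟧
    ≃⇒≐ = ⊆-to , ⊆-from
  open _≃_
  infix 4 _≃_

  ≐-trans : ∀ {P Q S} → P ≐ Q → Q ≐ S → P ≐ S
  ≐-trans (f , g) (f′ , g′) = (λ x → f′ x ∘ f x) , (λ x → g x ∘ g′ x)

  idealMonoid : CommutativeMonoid (lsuc (c ⊔ ℓ)) (c ⊔ ℓ)
  idealMonoid = record
    { Carrier = Ideal
    ; _≈_ = _≃_
    ; _∙_ = _⊗_
    ; ε = wholeᴵ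
    ; isCommutativeMonoid = record
      { isMonoid = record
        { isSemigroup = record
          { isMagma = record
            { isEquivalence = record
                { refl  = mk≃ (λ _ p → p) (λ _ p → p)
                ; sym   = λ (mk≃ f g) → mk≃ g f
                ; trans = λ (mk≃ f g) (mk≃ f′ g′) → mk≃ (λ x → f′ x ∘ f x) (λ x → g x ∘ g′ x)
                }
            ; ∙-cong = λ {A} {A′} {B} {B′} (mk≃ f g) (mk≃ f′ g′) →
                mk≃ (⊗-mono A A′ B B′ f f′) (⊗-mono A′ A B′ B g g′)
            }
          ; assoc = λ A B C → mk≃ (⊗-assoc-⊆ A B C) λ x →
              ⊗-comm-⊆ C (A ⊗ B) x
              ∘ ⊗-mono C C (B ⊗ A) (A ⊗ B) (λ _ p → p) (⊗-comm-⊆ B A) x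
              ∘ ⊗-assoc-⊆ C B A x
              ∘ ⊗-mono (B ⊗ C) (C ⊗ B) A A (⊗-comm-⊆ B C) (λ _ p → p) x
              ∘ ⊗-comm-⊆ A (B ⊗ C) x
          }
        ; identity = (λ A → mk≃ (⊗⊆ʳ wholeᴵ A) λ x x∈ →
                       Ideal.resp (wholeᴵ ⊗ A) (*-identityˡ x) (⊗-intro wholeᴵ A tt x∈))
                   , (λ A → mk≃ (⊗⊆ˡ A wholeᴵ) λ x x∈ →
                       Ideal.resp (A ⊗ wholeᴵ) (*-identityʳ x) (⊗-intro A wholeᴵ x∈ tt))
        }
      ; comm = λ A B → mk≃ (⊗-comm-⊆ A B) (⊗-comm-⊆ B A)
      }
    }

  module 𝕀 = CommutativeMonoid idealMonoid

  -- Powers of ideals and products given by exponent vectors.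

  infixr 8 _^_
  ^-isIdeal : ∀ A n → IsIdeal (⟦ A ⟧ ^ᴵ n)
  _^_ : Ideal → ℕ → Ideal

  A ^ n = ideal (⟦ A ⟧ ^ᴵ n) (^-isIdeal A n)

  ^-isIdeal A zero    = Ideal.isIdeal wholeᴵ
  ^-isIdeal A (suc n) = Ideal.isIdeal (A ⊗ (A ^ n))

  ^-anti : ∀ A {a b} → a ≤ b → ⟦ A ^ b ⟧ ⊆ ⟦ A ^ a ⟧
  ^-anti A z≤n x _ = tt
  ^-anti A {suc a} {suc b} (s≤s a≤b) =
    ⊗-mono A A (A ^ b) (A ^ a) (λ _ p → p) (^-anti A a≤b)

  ^suc⊆ : ∀ A n → ⟦ A ^ suc n ⟧ ⊆ ⟦ A ⟧
  ^suc⊆ A n = ⊗⊆ˡ A (A ^ n)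

  ^1≃ : ∀ A → A ^ 1 ≃ A
  ^1≃ A = 𝕀.identityʳ A

  ^-+ : ∀ A a b → A ^ (a +ℕ b) ≃ A ^ a ⊗ A ^ b
  ^-+ A zero    b = 𝕀.sym (𝕀.identityˡ (A ^ b))
  ^-+ A (suc a) b = begin
    A ⊗ A ^ (a +ℕ b)     ≈⟨ 𝕀.∙-congˡ (^-+ A a b) ⟩
    A ⊗ (A ^ a ⊗ A ^ b)  ≈⟨ 𝕀.assoc A (A ^ a) (A ^ b) ⟨
    (A ⊗ A ^ a) ⊗ A ^ b  ∎
    where open SetoidReasoning 𝕀.setoid

  ⌊_⌋ : MaxIdeal → Ideal
  ⌊ M ⌋ = ideal (carrier M) (IsMaximal.isIdeal (MaxIdeal.isMaximal M))

  ∏-isIdeal : ∀ {m} (F : Fin m → MaxIdeal) e → IsIdeal (prodF F e)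
  ∏ : ∀ {m} → (Fin m → MaxIdeal) → Exps m → Ideal

  ∏ F e = ideal (prodF F e) (∏-isIdeal F e)

  ∏-isIdeal {zero}  F e = Ideal.isIdeal wholeᴵ
  ∏-isIdeal {suc m} F e = Ideal.isIdeal (⌊ F zero ⌋ ^ e zero ⊗ ∏ (F ∘ suc) (e ∘ suc))

  ∏-anti : ∀ {m} (F : Fin m → MaxIdeal) {e e′ : Exps m} → (∀ l → e l ≤ e′ l) →
           ⟦ ∏ F e′ ⟧ ⊆ ⟦ ∏ F e ⟧
  ∏-anti {zero}  F le = λ _ p → p
  ∏-anti {suc m} F {e} {e′} le =
    ⊗-mono (⌊ F zero ⌋ ^ e′ zero) (⌊ F zero ⌋ ^ e zero)
           (∏ (F ∘ suc) (e′ ∘ suc)) (∏ (F ∘ suc) (e ∘ suc))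
           (^-anti ⌊ F zero ⌋ (le zero)) (∏-anti (F ∘ suc) (le ∘ suc))

  ∏-e₀ : ∀ {m} (F : Fin m → MaxIdeal) → ∏ F e₀ ≃ wholeᴵ
  ∏-e₀ {zero}  F = 𝕀.refl
  ∏-e₀ {suc m} F = 𝕀.trans (𝕀.identityˡ (∏ (F ∘ suc) e₀)) (∏-e₀ (F ∘ suc))

  raise : ∀ {m} → Fin m → ℕ → Exps m → Exps m
  raise zero    a e zero    = a +ℕ e zero
  raise zero    a e (suc i) = e (suc i)
  raise (suc j) a e zero    = e zero
  raise (suc j) a e (suc i) = raise j a (e ∘ suc) i

  ∏-raise : ∀ {m} (F : Fin m → MaxIdeal) j a e → ∏ F (raise j a e) ≃ ⌊ F j ⌋ ^ a ⊗ ∏ F e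
  ∏-raise F zero a e = begin
    F₀ ^ (a +ℕ e zero) ⊗ T      ≈⟨ 𝕀.∙-congʳ (^-+ F₀ a (e zero)) ⟩
    (F₀ ^ a ⊗ F₀ ^ e zero) ⊗ T  ≈⟨ 𝕀.assoc (F₀ ^ a) (F₀ ^ e zero) T ⟩
    F₀ ^ a ⊗ (F₀ ^ e zero ⊗ T)  ∎
    where
    open SetoidReasoning 𝕀.setoid
    F₀ = ⌊ F zero ⌋
    T  = ∏ (F ∘ suc) (e ∘ suc)
  ∏-raise F (suc j) a e = begin
    F₀ ⊗ ∏ (F ∘ suc) (raise j a (e ∘ suc))  ≈⟨ 𝕀.∙-congˡ (∏-raise (F ∘ suc) j a (e ∘ suc)) ⟩
    F₀ ⊗ (Fⱼ ⊗ T)                           ≈⟨ x∙yz≈y∙xz F₀ Fⱼ T ⟩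
    Fⱼ ⊗ (F₀ ⊗ T)                           ∎
    where
    open SetoidReasoning 𝕀.setoid
    open CommutativeSemigroupProperties 𝕀.commutativeSemigroup using (x∙yz≈y∙xz)
    F₀ = ⌊ F zero ⌋ ^ e zero
    Fⱼ = ⌊ F (suc j) ⌋ ^ a
    T  = ∏ (F ∘ suc) (e ∘ suc)

  single : ∀ {m} → Fin m → ℕ → Exps m
  single j a = raise j a e₀

  ∏-single : ∀ {m} (F : Fin m → MaxIdeal) j a → ∏ F (single j a) ≃ ⌊ F j ⌋ ^ a
  ∏-single F j a = begin
    ∏ F (single j a)       ≈⟨ ∏-raise F j a e₀ ⟩
    ⌊ F j ⌋ ^ a ⊗ ∏ F e₀   ≈⟨ 𝕀.∙-congˡ (∏-e₀ F) ⟩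
    ⌊ F j ⌋ ^ a ⊗ wholeᴵ   ≈⟨ 𝕀.identityʳ (⌊ F j ⌋ ^ a) ⟩
    ⌊ F j ⌋ ^ a            ∎
    where open SetoidReasoning 𝕀.setoid

  -- Built from `raise`, which adds exponents, so the product of ideals is preserved even if `f`
  -- repeats a value.
  push : ∀ {t m} → (Fin t → Fin m) → Exps t → Exps m
  push {zero}  f e = e₀
  push {suc t} f e = raise (f zero) (e zero) (push (f ∘ suc) (e ∘ suc))

  ∏-push : ∀ {t m} (F : Fin m → MaxIdeal) (f : Fin t → Fin m) e →
           ∏ F (push f e) ≃ ∏ (F ∘ f) e
  ∏-push {zero}  F f e = ∏-e₀ F
  ∏-push {suc t} F f e =
    𝕀.trans (∏-raise F (f zero) (e zero) (push (f ∘ suc) (e ∘ suc)))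
            (𝕀.∙-congˡ (∏-push F (f ∘ suc) (e ∘ suc)))

  -- Comaximality

  -- The condition A + B = R, kept as an element of B congruent to 1 modulo A. In this form the
  -- witnesses for B and B′ multiply to one for their product.
  Comax : Ideal → Ideal → Set (c ⊔ ℓ)
  Comax A B = ∃[ q ] ⟦ B ⟧ q × q ≡ 1# mod A

  comax-sym : ∀ A B → Comax A B → Comax B A
  comax-sym A B (q , q∈B , q≡1) = 1# - q , diff (mod-sym q≡1) , (begin
    1# - q    ≈⟨ mod-+ (≈⇒mod refl) (∈⇒mod (neg-closed B q∈B) (Ideal.0∈ B)) ⟩
    1# + 0#   ≈⟨ ≈⇒mod (+-identityʳ 1#) ⟩
    1#        ∎)
    where open ModReasoning B

  comax-monoʳ : ∀ A B B′ → ⟦ B ⟧ ⊆ ⟦ B′ ⟧ → Comax A B → Comax A B′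
  comax-monoʳ A B B′ B⊆ (q , q∈ , e) = q , B⊆ q q∈ , e

  comax-whole : ∀ A → Comax A wholeᴵ
  comax-whole A = 1# , tt , ≈⇒mod refl

  comax-⊗ : ∀ A B B′ → Comax A B → Comax A B′ → Comax A (B ⊗ B′)
  comax-⊗ A B B′ (q , q∈ , e) (q′ , q′∈ , e′) =
    q * q′ , ⊗-intro B B′ q∈ q′∈ , mod-trans (mod-* e e′) (≈⇒mod (*-identityˡ 1#))

  comax-^ : ∀ A B n → Comax A B → Comax A (B ^ n)
  comax-^ A B zero    h = comax-whole A
  comax-^ A B (suc n) h = comax-⊗ A B (B ^ n) h (comax-^ A B n h)

  comax-∏ : ∀ A {m} (F : Fin m → MaxIdeal) e → (∀ l → Comax A (⌊ F l ⌋ ^ e l)) →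
            Comax A (∏ F e)
  comax-∏ A {zero}  F e h = comax-whole A
  comax-∏ A {suc m} F e h =
    comax-⊗ A (⌊ F zero ⌋ ^ e zero) (∏ (F ∘ suc) (e ∘ suc)) (h zero)
      (comax-∏ A (F ∘ suc) (e ∘ suc) (h ∘ suc))

  -- Write x = (1 - q) x + x q: the first term has its factors in A and B because 1 - q is in A, the
  -- second because q is in B.
  comax-∩ : ∀ A B → Comax A B → ∀ {x} → ⟦ A ⟧ x → ⟦ B ⟧ x → ⟦ A ⊗ B ⟧ x
  comax-∩ A B (q , q∈B , q≡1) {x} x∈A x∈B = mod-∈ (A ⊗ B) x≡xq (⊗-intro A B x∈A q∈B)
    where
    eq : (1# - q) * x ≈ x - x * q
    eq = trans ([y-z]x≈yx-zx x 1# q) (+-cong (*-identityˡ x) (-‿cong (*-comm q x)))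
    x≡xq : x ≡ x * q mod A ⊗ B
    x≡xq = mk (Ideal.resp (A ⊗ B) eq (⊗-intro A B (diff (mod-sym q≡1)) x∈B))

  -- Each power is comaximal with the product of the later ones, so `comax-∩` absorbs one factor at
  -- a time.
  ∏-∩ : ∀ {t} (G : Fin t → MaxIdeal) e →
        (∀ l l′ → l ≢ l′ → Comax ⌊ G l ⌋ ⌊ G l′ ⌋) →
        ∀ {x} → (∀ l → ⟦ ⌊ G l ⌋ ^ e l ⟧ x) → ⟦ ∏ G e ⟧ x
  ∏-∩ {zero}  G e cop x∈ = tt
  ∏-∩ {suc t} G e cop x∈ =
    comax-∩ A (∏ (G ∘ suc) (e ∘ suc))
      (comax-∏ A (G ∘ suc) (e ∘ suc) λ l →
        comax-^ A ⌊ G (suc l) ⌋ (e (suc l))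
          (comax-sym ⌊ G (suc l) ⌋ A
            (comax-^ ⌊ G (suc l) ⌋ ⌊ G zero ⌋ (e zero) (cop (suc l) zero λ ()))))
      (x∈ zero)
      (∏-∩ (G ∘ suc) (e ∘ suc)
        (λ l l′ l≢ → cop (suc l) (suc l′) (l≢ ∘ Finₚ.suc-injective)) (x∈ ∘ suc))
    where A = ⌊ G zero ⌋ ^ e zero

  -- Principal ideals and units modulo an ideal.

  ⟪_⟫ : Carrier → Ideal
  ⟪ x ⟫ = ideal (λ z → ∃[ r ] z ≈ r * x) record
    { resp   = λ { z≈ (r , e) → r , trans (sym z≈) e }
    ; 0∈     = 0# , sym (zeroˡ x)
    ; +-clos = λ { (r , e) (r′ , e′) → r + r′ , trans (+-cong e e′) (sym (distribʳ x r r′)) }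
    ; *-clos = λ { s (r , e) → s * r , trans (*-congˡ e) (sym (*-assoc s r x)) }
    }

  ⟪⟫-self : ∀ x → ⟦ ⟪ x ⟫ ⟧ x
  ⟪⟫-self x = 1# , sym (*-identityˡ x)

  ⟪⟫⊆ : ∀ A {x} → ⟦ A ⟧ x → ⟦ ⟪ x ⟫ ⟧ ⊆ ⟦ A ⟧
  ⟪⟫⊆ A x∈ z (r , e) = Ideal.resp A (sym e) (Ideal.*-clos A r x∈)

  -- Invertibility modulo A is comaximality of A with (x), which makes the lemmas on `Comax`, its
  -- symmetry above all, available for units.
  UnitMod : Ideal → Carrier → Set (c ⊔ ℓ)
  UnitMod A x = Comax A ⟪ x ⟫

  unitMod-intro : ∀ A {x} r → r * x ≡ 1# mod A → UnitMod A x
  unitMod-intro A {x} r e = r * x , (r , refl) , e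

  unitMod-inverse : ∀ {A x} → UnitMod A x → ∃[ r ] r * x ≡ 1# mod A
  unitMod-inverse (q , (r , e) , q≡1) = r , mod-trans (≈⇒mod (sym e)) q≡1

  unitMod-≡1 : ∀ A {x} → x ≡ 1# mod A → UnitMod A x
  unitMod-≡1 A {x} e = x , ⟪⟫-self x , e

  unitMod-* : ∀ A {x y} → UnitMod A x → UnitMod A y → UnitMod A (x * y)
  unitMod-* A {x} {y} (q , (r , e) , q≡1) (q′ , (r′ , e′) , q′≡1) =
    q * q′ , (r * r′ , trans (*-cong e e′) (*-interchange r x r′ y)) ,
    mod-trans (mod-* q≡1 q′≡1) (≈⇒mod (*-identityˡ 1#))

  unitMod-mono : ∀ {A B x} → ⟦ A ⟧ ⊆ ⟦ B ⟧ → UnitMod A x → UnitMod B x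
  unitMod-mono A⊆B (q , q∈ , e) = q , q∈ , mod-mono A⊆B e

  -- Seen from the side of (x), comaximality with A passes to the powers of A.
  unitMod-^ : ∀ A {x} n → UnitMod A x → UnitMod (A ^ n) x
  unitMod-^ A {x} n h =
    comax-sym ⟪ x ⟫ (A ^ n) (comax-^ ⟪ x ⟫ A n (comax-sym A ⟪ x ⟫ h))

  unitMod-cancel : ∀ A {x y} → UnitMod A x → ⟦ A ⟧ (x * y) → ⟦ A ⟧ y
  unitMod-cancel A {x} {y} u xy∈ with unitMod-inverse u
  ... | r , rx≡1 = mod-∈ A (begin
    y            ≈⟨ ≈⇒mod (sym (*-identityˡ y)) ⟩
    1# * y       ≈⟨ mod-*ʳ y (mod-sym rx≡1) ⟩
    (r * x) * y  ≈⟨ ≈⇒mod (*-assoc r x y) ⟩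
    r * (x * y)  ∎) (Ideal.*-clos A r xy∈)
    where open ModReasoning A

  -- Finite products of elements.

  prod : ∀ {n} → (Fin n → Carrier) → Carrier
  prod {zero}  h = 1#
  prod {suc n} h = h zero * prod (h ∘ suc)

  prod-∈ : ∀ A {n} (h : Fin n → Carrier) l → ⟦ A ⟧ (h l) → ⟦ A ⟧ (prod h)
  prod-∈ A h zero    h∈ = *-closʳ A _ h∈
  prod-∈ A h (suc l) h∈ = Ideal.*-clos A _ (prod-∈ A (h ∘ suc) l h∈)

  prod-unitMod : ∀ A {n} (h : Fin n → Carrier) → (∀ l → UnitMod A (h l)) → UnitMod A (prod h)
  prod-unitMod A {zero}  h u = unitMod-≡1 A (≈⇒mod refl)
  prod-unitMod A {suc n} h u = unitMod-* A (u zero) (prod-unitMod A (h ∘ suc) (u ∘ suc))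

  prod-≡1 : ∀ A {n} (h : Fin n → Carrier) → (∀ l → h l ≡ 1# mod A) → prod h ≡ 1# mod A
  prod-≡1 A {zero}  h u = ≈⇒mod refl
  prod-≡1 A {suc n} h u =
    mod-trans (mod-* (u zero) (prod-≡1 A (h ∘ suc) (u ∘ suc))) (≈⇒mod (*-identityˡ 1#))

  prod-∣ : ∀ {n} (g h : Fin n → Carrier) → (∀ l → ⟦ ⟪ g l ⟫ ⟧ (h l)) → ⟦ ⟪ prod g ⟫ ⟧ (prod h)
  prod-∣ {zero}  g h d = 1# , sym (*-identityˡ 1#)
  prod-∣ {suc n} g h d with d zero | prod-∣ (g ∘ suc) (h ∘ suc) (d ∘ suc)
  ... | r , e | r′ , e′ = r * r′ , trans (*-cong e e′) (*-interchange r _ r′ _)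

  prod-cancel : ∀ A {n} (h : Fin n → Carrier) l → (∀ l′ → l′ ≢ l → UnitMod A (h l′)) →
                ⟦ A ⟧ (prod h) → ⟦ A ⟧ (h l)
  prod-cancel A h zero u p∈ =
    unitMod-cancel A (prod-unitMod A (h ∘ suc) (λ l → u (suc l) λ ()))
      (Ideal.resp A (*-comm _ _) p∈)
  prod-cancel A h (suc l) u p∈ =
    prod-cancel A (h ∘ suc) l (λ l′ l′≢ → u (suc l′) (l′≢ ∘ Finₚ.suc-injective))
      (unitMod-cancel A (u zero λ ()) p∈)

  -- Chinese remainders: for each other index take an element of A l′ that is 1 modulo A l, and
  -- multiply.
  comax-idempotents : ∀ {t} (A : Fin t → Ideal) → (∀ l l′ → l ≢ l′ → Comax (A l) (A l′)) →
    ∀ l → ∃[ ε ] (ε ≡ 1# mod A l) × (∀ l′ → l′ ≢ l → ⟦ A l′ ⟧ ε)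
  comax-idempotents A cop l =
    prod q , prod-≡1 (A l) q q≡1 , λ l′ l′≢l → prod-∈ (A l′) q l′ (q∈ l′ l′≢l)
    where
    pick : ∀ l′ → ∃[ x ] (x ≡ 1# mod A l) × (l′ ≢ l → ⟦ A l′ ⟧ x)
    pick l′ with l′ Finₚ.≟ l
    -- The index l itself contributes the neutral factor, so the product stays 1 modulo A l.
    ... | yes l′≡l = 1# , ≈⇒mod refl , λ l′≢l → ⊥-elim (l′≢l l′≡l)
    ... | no  l′≢l with cop l l′ (l′≢l ∘ ≡.sym)
    ...   | x , x∈ , e = x , e , λ _ → x∈
    q = λ l′ → proj₁ (pick l′)
    q≡1 = λ l′ → proj₁ (proj₂ (pick l′))
    q∈ = λ l′ → proj₂ (proj₂ (pick l′))

  -- Maximal ideals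

  -- Maximality is stated as a disjunction over all larger ideals; applied to M ∪ {x | P} it
  -- decides P.
  lem : MaxIdeal → (P : Set (c ⊔ ℓ)) → P ⊎ ¬ P
  lem M P with IsMaximal.maximal (MaxIdeal.isMaximal M) ⟦ M∪P ⟧ (Ideal.isIdeal M∪P) (λ _ → inj₁)
    where
    M∪P : Ideal
    M∪P = ideal (λ x → carrier M x ⊎ P) record
      { resp   = λ { x≈y (inj₁ x∈) → inj₁ (Ideal.resp ⌊ M ⌋ x≈y x∈) ; _ (inj₂ p) → inj₂ p }
      ; 0∈     = inj₁ (Ideal.0∈ ⌊ M ⌋)
      ; +-clos = λ { (inj₁ x∈) (inj₁ y∈) → inj₁ (Ideal.+-clos ⌊ M ⌋ x∈ y∈)
                   ; (inj₂ p) _ → inj₂ p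
                   ; _ (inj₂ p) → inj₂ p }
      ; *-clos = λ { r (inj₁ x∈) → inj₁ (Ideal.*-clos ⌊ M ⌋ r x∈) ; _ (inj₂ p) → inj₂ p }
      }
  ... | inj₁ ⊆M = inj₂ λ p → IsMaximal.proper (MaxIdeal.isMaximal M) (⊆M 1# (inj₂ p))
  ... | inj₂ (_ , ⊆M∪P) with ⊆M∪P 1# tt
  ...   | inj₁ 1∈M = ⊥-elim (IsMaximal.proper (MaxIdeal.isMaximal M) 1∈M)
  ...   | inj₂ p   = inj₁ p

  infixl 6 _⊞_
  _⊞_ : Ideal → Ideal → Ideal
  A ⊞ B = ideal (λ x → ∃[ a ] ⟦ A ⟧ a × x ≡ a mod B) record
    { resp   = λ { x≈y (a , a∈ , e) → a , a∈ , mod-trans (≈⇒mod (sym x≈y)) e }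
    ; 0∈     = 0# , Ideal.0∈ A , ≈⇒mod refl
    ; +-clos = λ { (a , a∈ , e) (a′ , a′∈ , e′) → a + a′ , Ideal.+-clos A a∈ a′∈ , mod-+ e e′ }
    ; *-clos = λ { r (a , a∈ , e) → r * a , Ideal.*-clos A r a∈ , mod-*ˡ r e }
    }

  ⊆⊞ˡ : ∀ A B → ⟦ A ⟧ ⊆ ⟦ A ⊞ B ⟧
  ⊆⊞ˡ A B x x∈ = x , x∈ , ≈⇒mod refl

  ⊆⊞ʳ : ∀ A B → ⟦ B ⟧ ⊆ ⟦ A ⊞ B ⟧
  ⊆⊞ʳ A B x x∈ = 0# , Ideal.0∈ A , ∈⇒mod0 x∈

  -- Maximality is applied to A + M: either it stays inside M, or it contains 1, and then the A-part
  -- of 1 is the witness.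
  ⊆-or-comax : ∀ M A → (⟦ A ⟧ ⊆ carrier M) ⊎ Comax ⌊ M ⌋ A
  ⊆-or-comax M A
    with IsMaximal.maximal (MaxIdeal.isMaximal M) ⟦ A ⊞ ⌊ M ⌋ ⟧ (Ideal.isIdeal (A ⊞ ⌊ M ⌋))
           (⊆⊞ʳ A ⌊ M ⌋)
  ... | inj₁ ⊆M = inj₁ λ x x∈ → ⊆M x (⊆⊞ˡ A ⌊ M ⌋ x x∈)
  ... | inj₂ (_ , g) with g 1# tt
  ...   | a , a∈ , e = inj₂ (a , a∈ , mod-sym e)

  ∉⇒unitMod : ∀ M {x} → ¬ carrier M x → UnitMod ⌊ M ⌋ x
  ∉⇒unitMod M {x} x∉ with ⊆-or-comax M ⟪ x ⟫
  ... | inj₁ ⊆M = ⊥-elim (x∉ (⊆M x (⟪⟫-self x)))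
  ... | inj₂ u  = u

  -- Otherwise M′ lies in M, and maximality of M′ leaves only M = M′ or M = R.
  ≢⇒comax : ∀ M M′ → ¬ (carrier M ≐ carrier M′) → Comax ⌊ M ⌋ ⌊ M′ ⌋
  ≢⇒comax M M′ M≢M′ with ⊆-or-comax M ⌊ M′ ⌋
  ... | inj₂ h = h
  ... | inj₁ M′⊆M
    with IsMaximal.maximal (MaxIdeal.isMaximal M′) (carrier M) (Ideal.isIdeal ⌊ M ⌋) M′⊆M
  ...   | inj₁ M⊆M′    = ⊥-elim (M≢M′ (M⊆M′ , M′⊆M))
  ...   | inj₂ (_ , g) = ⊥-elim (IsMaximal.proper (MaxIdeal.isMaximal M) (g 1# tt))

  -- The family may list an ideal several times. Going through it, `lem` decides whether the head
  -- recurs among the ideals already kept; if not, it is comaximal with all of them.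
  comaximal-subfamily : ∀ {m} (F : Fin m → MaxIdeal) →
    ∃[ t ] Σ (Fin t → Fin m) λ f →
      (∀ l l′ → l ≢ l′ → Comax ⌊ F (f l) ⌋ ⌊ F (f l′) ⌋)
      × (∀ j → ∃[ l ] carrier (F j) ≐ carrier (F (f l)))
  comaximal-subfamily {zero}  F = 0 , (λ ()) , (λ ()) , λ ()
  comaximal-subfamily {suc m} F with comaximal-subfamily (F ∘ suc)
  ... | t , f , cop , cover
    with lem (F zero) (∃[ l ] carrier (F zero) ≐ carrier (F (suc (f l))))
  ...   | inj₁ old = t , suc ∘ f , cop , λ { zero → old ; (suc j) → cover j }
  ...   | inj₂ new = suc t , (zero ∷ suc ∘ f)
    , (λ { zero zero 0≢0 → ⊥-elim (0≢0 ≡.refl)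
         ; zero (suc l) _ → fresh l
         ; (suc l) zero _ → comax-sym ⌊ F zero ⌋ ⌊ F (suc (f l)) ⌋ (fresh l)
         ; (suc l) (suc l′) l≢l′ → cop l l′ (l≢l′ ∘ ≡.cong suc) })
    , (λ { zero → zero , (λ _ p → p) , (λ _ p → p)
         ; (suc j) → suc (proj₁ (cover j)) , proj₂ (cover j) })
    where
    fresh : ∀ l → Comax ⌊ F zero ⌋ ⌊ F (suc (f l)) ⌋
    fresh l = ≢⇒comax (F zero) (F (suc (f l))) (λ eq → new (l , eq))

  -- Exponents of an element of M(R), and capped orders.

  ⨂ : ∀ {n} → (Fin n → MaxIdeal) → Ideal
  ⨂-isIdeal : ∀ {n} (L : Fin n → MaxIdeal) → IsIdeal (prodList L)

  ⨂ L = ideal (prodList L) (⨂-isIdeal L)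

  ⨂-isIdeal {zero}  L = Ideal.isIdeal wholeᴵ
  ⨂-isIdeal {suc n} L = Ideal.isIdeal (⌊ L zero ⌋ ⊗ ⨂ (L ∘ suc))

  ⨂⊆ : ∀ {n} (L : Fin n → MaxIdeal) i → ⟦ ⨂ L ⟧ ⊆ carrier (L i)
  ⨂⊆ L zero    = ⊗⊆ˡ ⌊ L zero ⌋ (⨂ (L ∘ suc))
  ⨂⊆ L (suc i) x = ⨂⊆ (L ∘ suc) i x ∘ ⊗⊆ʳ ⌊ L zero ⌋ (⨂ (L ∘ suc)) x

  -- Each factor of the list raises by one the exponent of the member of `G` that equals it.
  ⨂-exponents : ∀ {n t} (L : Fin n → MaxIdeal) (G : Fin t → MaxIdeal) →
    (∀ i → ∃[ l ] carrier (L i) ≐ carrier (G l)) → Σ (Exps t) λ e → ⨂ L ≃ ∏ G e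
  ⨂-exponents {zero}  L G cover = e₀ , 𝕀.sym (∏-e₀ G)
  ⨂-exponents {suc n} L G cover with cover zero | ⨂-exponents (L ∘ suc) G (cover ∘ suc)
  ... | l , f , g | e , eq = raise l 1 e , (begin
    ⌊ L zero ⌋ ⊗ ⨂ (L ∘ suc)  ≈⟨ 𝕀.∙-cong (mk≃ f g) eq ⟩
    ⌊ G l ⌋ ⊗ ∏ G e           ≈⟨ 𝕀.∙-congʳ (^1≃ ⌊ G l ⌋) ⟨
    ⌊ G l ⌋ ^ 1 ⊗ ∏ G e       ≈⟨ ∏-raise G l 1 e ⟨
    ∏ G (raise l 1 e)         ∎)
    where open SetoidReasoning 𝕀.setoid

  -- The order of `a` at M cut off at n. The cap gives a value also to elements lying in every
  -- power; the search descends from n.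
  cappedOrder : ∀ (M : MaxIdeal) a n →
    ∃[ e ] e ≤ n × ⟦ ⌊ M ⌋ ^ e ⟧ a × (e ≡ n ⊎ ¬ ⟦ ⌊ M ⌋ ^ suc e ⟧ a)
  cappedOrder M a zero = 0 , z≤n , tt , inj₁ ≡.refl
  cappedOrder M a (suc n) with lem M (⟦ ⌊ M ⌋ ^ suc n ⟧ a)
  ... | inj₁ a∈ = suc n , ℕₚ.≤-refl , a∈ , inj₁ ≡.refl
  ... | inj₂ a∉ with cappedOrder M a n
  -- Reaching the lower cap n is now an exact order, since `a` was found outside the power n + 1.
  ...   | e , e≤n , a∈ , inj₁ ≡.refl = e , ℕₚ.n≤1+n n , a∈ , inj₂ a∉
  ...   | e , e≤n , a∈ , inj₂ a∉′    = e , ℕₚ.m≤n⇒m≤1+n e≤n , a∈ , inj₂ a∉′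

  -- Division by an element of exact order at a maximal ideal.

  mod-⊗ˡ : ∀ A B {x y z} → x ≡ y mod A → ⟦ B ⟧ z → x * z ≡ y * z mod A ⊗ B
  mod-⊗ˡ A B {x} {y} {z} (mk d) z∈ =
    mk (Ideal.resp (A ⊗ B) ([y-z]x≈yx-zx z x y) (⊗-intro A B d z∈))

  mod-⊗ʳ : ∀ A B {x y z} → ⟦ A ⟧ z → x ≡ y mod B → z * x ≡ z * y mod A ⊗ B
  mod-⊗ʳ A B {x} {y} {z} z∈ (mk d) =
    mk (Ideal.resp (A ⊗ B) (x[y-z]≈xy-xz z x y) (⊗-intro A B z∈ d))

  ⊗-⊞ : ∀ A S C D → ⟦ C ⟧ ⊆ ⟦ S ⊞ D ⟧ → ⟦ A ⊗ C ⟧ ⊆ ⟦ S ⊞ A ⊗ D ⟧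
  ⊗-⊞ A S C D C⊆ = ⊗-elim A C (S ⊞ A ⊗ D) step
    where
    step : ∀ {z y} → ⟦ A ⟧ z → ⟦ C ⟧ y → ⟦ S ⊞ A ⊗ D ⟧ (z * y)
    step {z} {y} z∈ y∈ with C⊆ y y∈
    ... | b , b∈ , y≡b = z * b , Ideal.*-clos S z b∈ , mod-⊗ʳ A D z∈ y≡b

  ⊞-trans : ∀ S C D E → ⟦ C ⟧ ⊆ ⟦ S ⊞ D ⟧ → ⟦ D ⟧ ⊆ ⟦ S ⊞ E ⟧ → ⟦ C ⟧ ⊆ ⟦ S ⊞ E ⟧
  ⊞-trans S C D E C⊆ D⊆ x x∈ with C⊆ x x∈
  ... | a , a∈ , x≡a =
    mod-∈ (S ⊞ E) (mk {A = S ⊞ E} (D⊆ (x - a) (diff x≡a))) (⊆⊞ˡ S E a a∈)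

  module _ (M : MaxIdeal) (e : ℕ) (dim : Dim1 (carrier M) e) {σ : Carrier}
           (σ∈ : ⟦ ⌊ M ⌋ ^ e ⟧ σ) (σ∉ : ¬ ⟦ ⌊ M ⌋ ^ suc e ⟧ σ) where

    private
      A = ⌊ M ⌋

    -- A generator g of the one-dimensional quotient satisfies σ ≡ t g. Here t is outside M, since
    -- otherwise σ would lie in the next power; inverting t modulo M writes g, and so everything, as
    -- a multiple of σ.
    exact-order-spans₁ : ⟦ A ^ e ⟧ ⊆ ⟦ ⟪ σ ⟫ ⊞ A ^ suc e ⟧
    exact-order-spans₁ x x∈ = (u * r) * σ , (u * r , refl) , (begin
      x                  ≈⟨ mk (proj₂ (span x x∈)) ⟩
      u * g              ≈⟨ mod-*ˡ u (≈⇒mod (sym (*-identityˡ g))) ⟩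
      u * (1# * g)       ≈⟨ mod-*ˡ u (mod-⊗ˡ A (A ^ e) (mod-sym (proj₂ t⁻¹)) g∈) ⟩
      u * ((r * t) * g)  ≈⟨ mod-*ˡ u (≈⇒mod (*-assoc r t g)) ⟩
      u * (r * (t * g))  ≈⟨ mod-*ˡ u (mod-*ˡ r (mod-sym σ≡tg)) ⟩
      u * (r * σ)        ≈⟨ ≈⇒mod (sym (*-assoc u r σ)) ⟩
      (u * r) * σ        ∎)
      where
      open ModReasoning (A ^ suc e)
      g = proj₁ dim
      g∈ = proj₁ (proj₂ dim)
      span = proj₂ (proj₂ (proj₂ dim))
      u = proj₁ (span x x∈)
      t = proj₁ (span σ σ∈)
      σ≡tg : σ ≡ t * g mod A ^ suc e
      σ≡tg = mk (proj₂ (span σ σ∈))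
      t∉ : ¬ carrier M t
      t∉ t∈ = σ∉ (mod-∈ (A ^ suc e) σ≡tg (⊗-intro A (A ^ e) t∈ g∈))
      t⁻¹ = unitMod-inverse (∉⇒unitMod M t∉)
      r = proj₁ t⁻¹

    -- Multiplying the inclusion for d by M starts it at the power e + 1, and `exact-order-spans₁`
    -- bridges from e to e + 1.
    exact-order-spans : ∀ d → ⟦ A ^ e ⟧ ⊆ ⟦ ⟪ σ ⟫ ⊞ A ^ (d +ℕ e) ⟧
    exact-order-spans zero    = ⊆⊞ʳ ⟪ σ ⟫ (A ^ e)
    exact-order-spans (suc d) =
      ⊞-trans ⟪ σ ⟫ (A ^ e) (A ^ suc e) (A ^ suc (d +ℕ e)) exact-order-spans₁
        (⊗-⊞ A ⟪ σ ⟫ (A ^ e) (A ^ (d +ℕ e)) (exact-order-spans d))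

    exact-order-divides : ∀ N {x} → ⟦ A ^ e ⟧ x → ∃[ r ] σ * r ≡ x mod A ^ N
    -- Taking d = N overshoots to the power N + e, which is contained in the power N.
    exact-order-divides N x∈ with exact-order-spans N _ x∈
    ... | a , (r , a≈) , x≡a = r , mod-sym
      (mod-trans (mod-mono (^-anti A (ℕₚ.m≤m+n N e)) x≡a) (≈⇒mod (trans a≈ (*-comm r σ))))

    -- If r were in M, then σ r, and with it x, would lie in the power e + 1.
    exact-order-quotient-∉ : ∀ N {x r} → suc e ≤ N → ¬ ⟦ A ^ suc e ⟧ x →
                             σ * r ≡ x mod A ^ N → ¬ carrier M r
    exact-order-quotient-∉ N {x} {r} e<N x∉ σr≡x r∈ =
      x∉ (mod-∈ (A ^ suc e) (mod-sym (mod-mono (^-anti A e<N) σr≡x))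
        (Ideal.resp (A ^ suc e) (*-comm r σ) (⊗-intro A (A ^ e) r∈ σ∈)))

  -- Unimodular rows

  genᴵ : ∀ {n} → (Fin n → Carrier) → Ideal
  genᴵ {n} a = ideal (gen a) record
    { resp   = λ { x≈y (r , e) → r , trans (sym x≈y) e }
    ; 0∈     = (λ _ → 0#) , sym (trans (sumF-cong λ i → zeroˡ (a i)) (sumF-0 n))
    ; +-clos = λ { (r , e) (r′ , e′) → (λ i → r i + r′ i) , trans (+-cong e e′)
        (trans (sumF-+ (λ i → r i * a i) (λ i → r′ i * a i))
               (sumF-cong λ i → sym (distribʳ (a i) (r i) (r′ i)))) }
    ; *-clos = λ { s (r , e) → (λ i → s * r i) , trans (*-congˡ e)
        (trans (*-sumF s (λ i → r i * a i)) (sumF-cong λ i → sym (*-assoc s (r i) (a i)))) }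
    }

  gen-∈ : ∀ {n} (a : Fin n → Carrier) i → ⟦ genᴵ a ⟧ (a i)
  gen-∈ {suc n} a zero = (1# ∷ λ _ → 0#) , sym (trans
    (+-cong (*-identityˡ (a zero)) (trans (sumF-cong λ i → zeroˡ (a (suc i))) (sumF-0 n)))
    (+-identityʳ (a zero)))
  gen-∈ {suc n} a (suc i) with gen-∈ (a ∘ suc) i
  ... | r , e = (0# ∷ r) , trans e (sym (trans (+-congʳ (zeroˡ (a zero))) (+-identityˡ _)))

  gen-elim : ∀ {n} (a : Fin n → Carrier) A → (∀ i → ⟦ A ⟧ (a i)) → gen a ⊆ ⟦ A ⟧
  gen-elim a A a∈ x (r , e) = Ideal.resp A (sym e)
    (sumF-closed A (λ i → r i * a i) (λ i → Ideal.*-clos A (r i) (a∈ i)))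

  mod-absorb : ∀ {A x y} → ⟦ A ⟧ y → x + y ≡ x mod A
  mod-absorb y∈ = mod-trans (mod-+ (≈⇒mod refl) (∈⇒mod0 y∈)) (≈⇒mod (+-identityʳ _))

  -- As x p vanishes, entry p is unchanged, so subtracting its multiples recovers every old entry.
  transvection-unimodular : ∀ {n} (v x : Fin n → Carrier) p → x p ≈ 0# →
    gen v 1# → gen (λ i → v i + x i * v p) 1#
  transvection-unimodular v x p xp≈0 = gen-elim v T v∈ 1#
    where
    T = genᴵ (λ i → v i + x i * v p)
    vp∈ : ⟦ T ⟧ (v p)
    vp∈ = Ideal.resp T
      (trans (+-congˡ (trans (*-congʳ xp≈0) (zeroˡ (v p)))) (+-identityʳ (v p))) (gen-∈ _ p)
    v∈ : ∀ i → ⟦ T ⟧ (v i)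
    v∈ i = mod-∈ T (mod-sym (mod-absorb (Ideal.*-clos T (x i) vp∈))) (gen-∈ _ i)

  -- Since g i divides z, each v i multiplies z into the new ideal T. Hence the colon ideal (T : z)
  -- contains all v i, and with them 1.
  common-multiple∈gen : ∀ {n} (g v : Fin n → Carrier) {z} → gen v 1# →
    (∀ i → ⟦ ⟪ g i ⟫ ⟧ z) → gen (λ i → g i * v i) z
  common-multiple∈gen g v {z} 1∈ g∣z =
    Ideal.resp T (*-identityˡ z) (gen-elim v (colon T z) vz∈ 1# 1∈)
    where
    T = genᴵ (λ i → g i * v i)
    vz∈ : ∀ i → ⟦ T ⟧ (v i * z)
    vz∈ i with g∣z i
    ... | r , z≈rg = Ideal.resp T
      (trans (x*yz≈z*yx r (g i) (v i)) (*-congˡ (trans (*-comm (g i) r) (sym z≈rg))))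
      (Ideal.*-clos T r (gen-∈ _ i))

  e₁ : ∀ {k} → Fin (suc k) → Carrier
  e₁ = 1# ∷ λ _ → 0#

  module _ {k} (A : Ideal) {ε} (ε≡1 : ε ≡ 1# mod A) (v : Fin (suc k) → Carrier)
           (1∈ : gen v 1#) (v≡e₁ : ∀ i → v i ≡ e₁ i mod A) (w : Fin (suc k) → Carrier) where

    private
      -- The last component says that the row does not move modulo ideals containing ε, so what was
      -- arranged at other moduli survives.
      Result : (Fin (suc k) → Carrier) → Set (lsuc (c ⊔ ℓ))
      Result u = gen u 1# × (∀ i → u i ≡ w i mod A)
                 × (∀ B → ⟦ B ⟧ ε → ∀ i → u i ≡ v i mod B)

      x : Fin (suc k) → Carrier
      -- The factor ε is 1 modulo A and kills the change wherever ε vanishes.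
      x = 0# ∷ λ i → ε * w (suc i)

      u : Fin (suc k) → Carrier
      u i = v i + x i * v zero

      u₀≡1 : u zero ≡ 1# mod A
      u₀≡1 = mod-trans (mod-absorb (Ideal.resp A (sym (zeroˡ _)) (Ideal.0∈ A))) (v≡e₁ zero)

      uᵢ≡wᵢ : ∀ i → u (suc i) ≡ w (suc i) mod A
      uᵢ≡wᵢ i = begin
        v (suc i) + ε * w (suc i) * v zero
          ≈⟨ mod-+ (v≡e₁ (suc i)) (mod-* (mod-*ʳ (w (suc i)) ε≡1) (v≡e₁ zero)) ⟩
        0# + 1# * w (suc i) * 1#
          ≈⟨ ≈⇒mod (trans (+-identityˡ _) (trans (*-identityʳ _) (*-identityˡ _))) ⟩
        w (suc i) ∎
        where open ModReasoning A

      u-unimodular : gen u 1#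
      u-unimodular = transvection-unimodular v x zero refl 1∈

      u≡v : ∀ B → ⟦ B ⟧ ε → ∀ i → u i ≡ v i mod B
      u≡v B ε∈ i = mod-absorb (*-closʳ B (v zero) (x∈ i))
        where
        x∈ : ∀ i → ⟦ B ⟧ (x i)
        x∈ zero    = Ideal.0∈ B
        x∈ (suc i) = *-closʳ B (w (suc i)) ε∈

    -- The first transvection uses the 1 in position zero to install every other entry of w;
    -- entry zero is then corrected using the 1 that w has in position p.
    move-e₁ : ∀ p → w p ≈ 1# → ∃[ u ] Result u
    move-e₁ zero w₀≈1 = u , u-unimodular
      , (λ { zero → mod-trans u₀≡1 (≈⇒mod (sym w₀≈1)) ; (suc i) → uᵢ≡wᵢ i }) , u≡v
    move-e₁ (suc p) wₚ≈1 = (λ i → u i + y i * u (suc p))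
      , transvection-unimodular u y (suc p) refl u-unimodular
      , (λ { zero → u′₀≡w₀ ; (suc i) → mod-trans (mod-absorb (0*∈ A)) (uᵢ≡wᵢ i) })
      , λ B ε∈ i → mod-trans (mod-absorb (*-closʳ B (u (suc p)) (y∈ B ε∈ i))) (u≡v B ε∈ i)
      where
      y : Fin (suc k) → Carrier
      y = ε * (w zero - 1#) ∷ λ _ → 0#
      0*∈ : ∀ B {z} → ⟦ B ⟧ (0# * z)
      0*∈ B {z} = *-closʳ B z (Ideal.0∈ B)
      y∈ : ∀ B → ⟦ B ⟧ ε → ∀ i → ⟦ B ⟧ (y i)
      y∈ B ε∈ zero    = *-closʳ B _ ε∈
      y∈ B ε∈ (suc i) = Ideal.0∈ B
      u′₀≡w₀ : u zero + y zero * u (suc p) ≡ w zero mod A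
      u′₀≡w₀ = begin
        u zero + ε * (w zero - 1#) * u (suc p)
          ≈⟨ mod-+ u₀≡1 (mod-* (mod-*ʳ (w zero - 1#) ε≡1)
               (mod-trans (uᵢ≡wᵢ p) (≈⇒mod wₚ≈1))) ⟩
        1# + 1# * (w zero - 1#) * 1#
          ≈⟨ ≈⇒mod (+-congˡ (trans (*-identityʳ _) (*-identityˡ _))) ⟩
        1# + (w zero - 1#)
          ≈⟨ ≈⇒mod (trans (sym (+-assoc _ _ _)) (xyx⁻¹≈y 1# (w zero))) ⟩
        w zero ∎
        where open ModReasoning A

  -- Induction on the moduli. The last clause keeps the row equal to (1, 0, ..., 0) wherever all ε
  -- used so far vanish, which is the starting point `move-e₁` needs at the next modulus.
  lift-unimodular : ∀ {t k} (A : Fin t → Ideal) (ε : Fin t → Carrier) →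
    (∀ l → ε l ≡ 1# mod A l) → (∀ l l′ → l′ ≢ l → ⟦ A l′ ⟧ (ε l)) →
    (w : Fin t → Fin (suc k) → Carrier) (p : Fin t → Fin (suc k)) → (∀ l → w l (p l) ≈ 1#) →
    ∃[ v ] gen v 1# × (∀ l i → v i ≡ w l i mod A l)
           × (∀ B → (∀ l → ⟦ B ⟧ (ε l)) → ∀ i → v i ≡ e₁ i mod B)
  lift-unimodular {zero} A ε ε≡1 ε∈ w p w≈1 =
    e₁ , gen-∈ e₁ zero , (λ ()) , λ _ _ _ → ≈⇒mod refl
  lift-unimodular {suc t} A ε ε≡1 ε∈ w p w≈1
    with lift-unimodular (A ∘ suc) (ε ∘ suc) (ε≡1 ∘ suc)
           (λ l l′ l′≢l → ε∈ (suc l) (suc l′) (l′≢l ∘ Finₚ.suc-injective))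
           (w ∘ suc) (p ∘ suc) (w≈1 ∘ suc)
  ... | v , 1∈ , v≡w , v≡e₁
    with move-e₁ (A zero) (ε≡1 zero) v 1∈ (v≡e₁ (A zero) (λ l → ε∈ (suc l) zero λ ()))
           (w zero) (p zero) (w≈1 zero)
  ... | u , 1∈′ , u≡w , u≡v = u , 1∈′
    , (λ { zero → u≡w
         ; (suc l) i → mod-trans (u≡v (A (suc l)) (ε∈ zero (suc l) λ ()) i) (v≡w l i) })
    , λ B ε∈B i → mod-trans (u≡v B (ε∈B zero) i) (v≡e₁ B (ε∈B ∘ suc) i)

  -- Sums of families of ideals.

  sumᴵ : ∀ {n} → (Fin n → Ideal) → Ideal
  sumᴵ {n} A = ideal (sumIdeals (⟦_⟧ ∘ A)) record
    { resp   = λ { x≈y (a , a∈ , e) → a , a∈ , trans (sym x≈y) e }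
    ; 0∈     = (λ _ → 0#) , (λ i → Ideal.0∈ (A i)) , sym (sumF-0 n)
    ; +-clos = λ { (a , a∈ , e) (a′ , a′∈ , e′) →
        (λ i → a i + a′ i) , (λ i → Ideal.+-clos (A i) (a∈ i) (a′∈ i)) ,
        trans (+-cong e e′) (sumF-+ a a′) }
    ; *-clos = λ { r (a , a∈ , e) →
        (λ i → r * a i) , (λ i → Ideal.*-clos (A i) r (a∈ i)) ,
        trans (*-congˡ e) (*-sumF r a) }
    }

  ⊆sumᴵ : ∀ {n} (A : Fin n → Ideal) i → ⟦ A i ⟧ ⊆ ⟦ sumᴵ A ⟧
  ⊆sumᴵ {suc n} A zero x x∈ = (x ∷ λ _ → 0#)
    , (λ { zero → x∈ ; (suc i) → Ideal.0∈ (A (suc i)) })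
    , sym (trans (+-congˡ (sumF-0 n)) (+-identityʳ x))
  ⊆sumᴵ {suc n} A (suc i) x x∈ with ⊆sumᴵ (A ∘ suc) i x x∈
  ... | a , a∈ , e = (0# ∷ a)
    , (λ { zero → Ideal.0∈ (A zero) ; (suc j) → a∈ j })
    , trans e (sym (+-identityˡ _))

  comax⇒1∈ : ∀ A B → ⟦ B ⟧ ⊆ ⟦ A ⟧ → Comax A B → ⟦ A ⟧ 1#
  comax⇒1∈ A B B⊆A (q , q∈ , e) = mod-∈ A (mod-sym e) (B⊆A q q∈)

  -- The local construction at pairwise comaximal maximal ideals

  module Representative
    {t} (G : Fin t → MaxIdeal) (cop : ∀ l l′ → l ≢ l′ → Comax ⌊ G l ⌋ ⌊ G l′ ⌋)
    (dim : ∀ l i → Dim1 (carrier (G l)) i)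
    -- `s l d` stands for the value of Σ at the power d of `G l`.
    (s : Fin t → ℕ → Carrier)
    (s∈ : ∀ l d → ⟦ ⌊ G l ⌋ ^ d ⟧ (s l d))
    (s∉ : ∀ l d → ¬ ⟦ ⌊ G l ⌋ ^ suc d ⟧ (s l d))
    (s₀≈1 : ∀ l → s l 0 ≈ 1#)
    (s-coprime : ∀ l l′ → l ≢ l′ → ∀ d d′ → UnitMod ⟪ s l d ⟫ (s l′ d′))
    (n : Exps t) {k} (a : Fin (suc k) → Carrier) (1∈a : gen a 1#)
    where

    order : ∀ i l → ∃[ d ] d ≤ n l × ⟦ ⌊ G l ⌋ ^ d ⟧ (a i) × (d ≡ n l ⊎ ¬ ⟦ ⌊ G l ⌋ ^ suc d ⟧ (a i))
    order i l = cappedOrder (G l) (a i) (n l)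

    e : Fin (suc k) → Exps t
    e i l = proj₁ (order i l)

    e≤n : ∀ i l → e i l ≤ n l
    e≤n i l = proj₁ (proj₂ (order i l))

    -- If every entry were in `G l`, so would be 1; `lem` makes both the search and the membership
    -- tests decidable.
    pivot : ∀ l → ∃[ i ] ¬ carrier (G l) (a i)
    pivot l with lem (G l) (∃[ i ] ¬ carrier (G l) (a i))
    ... | inj₁ found = found
    ... | inj₂ none  = ⊥-elim (IsMaximal.proper (MaxIdeal.isMaximal (G l))
                                 (gen-elim a ⌊ G l ⌋ a∈ 1# 1∈a))
      where
      a∈ : ∀ i → carrier (G l) (a i)
      a∈ i with lem (G l) (carrier (G l) (a i))
      ... | inj₁ ∈G = ∈G
      ... | inj₂ ∉G = ⊥-elim (none (i , ∉G))

    p : Fin t → Fin (suc k)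
    p l = proj₁ (pivot l)

    order-unit : ∀ A d {x} → ⟦ A ^ d ⟧ x → ¬ ⟦ A ⟧ x → d ≡ 0
    order-unit A zero    x∈ x∉ = ≡.refl
    order-unit A (suc d) x∈ x∉ = ⊥-elim (x∉ (^suc⊆ A d _ x∈))

    e-pivot : ∀ l → e (p l) l ≡ 0
    e-pivot l = order-unit ⌊ G l ⌋ (e (p l) l) (proj₁ (proj₂ (proj₂ (order (p l) l))))
                  (proj₂ (pivot l))

    -- This is Σ(J_i), factored by condition (3) in `σ-push`.
    σ̂ : Fin (suc k) → Carrier
    σ̂ i = prod (λ l → s l (e i l))

    -- The first factor puts y l in G l ^ suc (n l); the others make σ̂ i divide the product
    -- of all y l.
    y : Fin t → Carrier
    y l = s l (suc (n l)) * prod (λ i → s l (e i l))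

    ⟪y⟫⊆ : ∀ l → ⟦ ⟪ y l ⟫ ⟧ ⊆ ⟦ ⌊ G l ⌋ ^ suc (n l) ⟧
    ⟪y⟫⊆ l = ⟪⟫⊆ A (*-closʳ A (prod (λ i → s l (e i l))) (s∈ l (suc (n l))))
      where A = ⌊ G l ⌋ ^ suc (n l)

    s∣y : ∀ i l → ⟦ ⟪ s l (e i l) ⟫ ⟧ (y l)
    s∣y i l = Ideal.*-clos A (s l (suc (n l))) (prod-∈ A (λ i → s l (e i l)) i (⟪⟫-self _))
      where A = ⟪ s l (e i l) ⟫

    s-unitMod-y : ∀ l l′ → l′ ≢ l → ∀ d → UnitMod ⟪ y l ⟫ (s l′ d)
    s-unitMod-y l l′ l′≢l d = comax-sym A ⟪ y l ⟫
      (unitMod-* A (s-coprime l′ l l′≢l d (suc (n l)))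
        (prod-unitMod A (λ i → s l (e i l)) (λ i → s-coprime l′ l l′≢l d (e i l))))
      where A = ⟪ s l′ d ⟫

    y-comax : ∀ l l′ → l ≢ l′ → Comax ⟪ y l ⟫ ⟪ y l′ ⟫
    y-comax l l′ l≢l′ = unitMod-* A (s-unitMod-y l l′ (l≢l′ ∘ ≡.sym) (suc (n l′)))
      (prod-unitMod A (λ i → s l′ (e i l′)) (λ i → s-unitMod-y l l′ (l≢l′ ∘ ≡.sym) (e i l′)))
      where A = ⟪ y l ⟫

    -- The factor at l is `s l 0`, that is 1, because the pivot has order 0 there; all other factors
    -- are coprime to `y l`.
    σ̂-pivot : ∀ l → UnitMod ⟪ y l ⟫ (σ̂ (p l))
    σ̂-pivot l = prod-unitMod ⟪ y l ⟫ (λ l′ → s l′ (e (p l) l′)) factor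
      where
      factor : ∀ l′ → UnitMod ⟪ y l ⟫ (s l′ (e (p l) l′))
      factor l′ with l′ Finₚ.≟ l
      ... | no  l′≢l   = s-unitMod-y l l′ l′≢l (e (p l) l′)
      ... | yes ≡.refl = unitMod-≡1 ⟪ y l ⟫
        (≈⇒mod (trans (reflexive (≡.cong (s l) (e-pivot l))) (s₀≈1 l)))

    σ̂∈ : ∀ i l → ⟦ ⌊ G l ⌋ ^ e i l ⟧ (σ̂ i)
    σ̂∈ i l = prod-∈ (⌊ G l ⌋ ^ e i l) (λ l → s l (e i l)) l (s∈ l (e i l))

    -- The factors at l′ ≠ l are units modulo `y l`, hence modulo this power of `G l`; cancelling
    -- them leaves `s∉`.
    σ̂∉ : ∀ i l → ¬ ⟦ ⌊ G l ⌋ ^ suc (e i l) ⟧ (σ̂ i)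
    σ̂∉ i l σ̂∈′ = s∉ l (e i l) (prod-cancel A (λ l → s l (e i l)) l
      (λ l′ l′≢l → unitMod-mono (λ x → ^-anti ⌊ G l ⌋ (s≤s (e≤n i l)) x ∘ ⟪y⟫⊆ l x)
        (s-unitMod-y l l′ l′≢l (e i l′))) σ̂∈′)
      where A = ⌊ G l ⌋ ^ suc (e i l)

    module _ (l : Fin t) where

      private
        A = ⌊ G l ⌋
        -- One power beyond n l, so that non-membership in the power `suc (e i l)` is visible modulo
        -- it even if `e i l` equals n l.
        A^ = A ^ suc (n l)

      aₚ⁻¹ : ∃[ r ] r * a (p l) ≡ 1# mod A^
      aₚ⁻¹ = unitMod-inverse (unitMod-^ A (suc (n l)) (∉⇒unitMod (G l) (proj₂ (pivot l))))

      -- The quotient of σ̂ by `a` at the pivot, chosen so that w = 1 solves the congruence there.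
      scale : Carrier
      scale = proj₁ aₚ⁻¹ * σ̂ (p l)

      scale-unit : UnitMod A^ scale
      scale-unit = unitMod-* A^
        (unitMod-intro A^ (a (p l)) (mod-trans (≈⇒mod (*-comm _ _)) (proj₂ aₚ⁻¹)))
        (unitMod-mono (⟪y⟫⊆ l) (σ̂-pivot l))

      1∉ : ¬ carrier (G l) 1#
      1∉ = IsMaximal.proper (MaxIdeal.isMaximal (G l))

      LocalSolution : Fin (suc k) → Carrier → Set (c ⊔ ℓ)
      LocalSolution i w = ¬ carrier (G l) w × σ̂ i * w ≡ scale * a i mod A ^ n l

      pivot-solution : LocalSolution (p l) 1#
      pivot-solution = 1∉ , mod-mono (^-anti A (ℕₚ.n≤1+n (n l))) (begin
        σ̂ (p l) * 1#             ≈⟨ mod-*ˡ (σ̂ (p l)) (proj₂ aₚ⁻¹) ⟨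
        σ̂ (p l) * (r * a (p l))  ≈⟨ ≈⇒mod (x*yz≈yx*z (σ̂ (p l)) r (a (p l))) ⟩
        (r * σ̂ (p l)) * a (p l)  ∎)
        where
        open ModReasoning A^
        r = proj₁ aₚ⁻¹

      -- If the order reaches the cap, both sides vanish modulo the power n l and w = 1 will do.
      -- Otherwise σ̂ i and the scaled a i have the same exact order, so their quotient exists and
      -- avoids `G l`.
      solution : ∀ i → ∃[ w ] LocalSolution i w
      solution i = [ saturated , unsaturated ]′ (proj₂ (proj₂ (proj₂ (order i l))))
        where
        d = e i l
        a∈ : ⟦ A ^ d ⟧ (a i)
        a∈ = proj₁ (proj₂ (proj₂ (order i l)))
        saturated : d ≡ n l → ∃[ w ] LocalSolution i w
        saturated d≡n = 1# , 1∉ , ∈⇒mod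
          (*-closʳ (A ^ n l) 1# (≡.subst (λ d → ⟦ A ^ d ⟧ (σ̂ i)) d≡n (σ̂∈ i l)))
          (Ideal.*-clos (A ^ n l) scale (≡.subst (λ d → ⟦ A ^ d ⟧ (a i)) d≡n a∈))
        unsaturated : ¬ ⟦ A ^ suc d ⟧ (a i) → ∃[ w ] LocalSolution i w
        unsaturated a∉ = proj₁ quotient
          , exact-order-quotient-∉ (G l) d (dim l d) (σ̂∈ i l) (σ̂∉ i l) (suc (n l)) (s≤s (e≤n i l))
              (λ λa∈ → a∉ (unitMod-cancel (A ^ suc d)
                (unitMod-mono (^-anti A (s≤s (e≤n i l))) scale-unit) λa∈))
              (proj₂ quotient)
          , mod-mono (^-anti A (ℕₚ.n≤1+n (n l))) (proj₂ quotient)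
          where
          quotient : ∃[ w ] σ̂ i * w ≡ scale * a i mod A^
          quotient = exact-order-divides (G l) d (dim l d) (σ̂∈ i l) (σ̂∉ i l) (suc (n l))
                       (Ideal.*-clos (A ^ d) scale a∈)

      -- Forces the entry 1 at the pivot, as `lift-unimodular` requires.
      normalized-solution : ∀ i → Dec (i ≡ p l) → ∃[ w ] LocalSolution i w × (i ≡ p l → w ≈ 1#)
      normalized-solution i (yes i≡p) =
        1# , ≡.subst (λ i → LocalSolution i 1#) (≡.sym i≡p) pivot-solution , λ _ → refl
      normalized-solution i (no i≢p) =
        proj₁ (solution i) , proj₂ (solution i) , λ i≡p → ⊥-elim (i≢p i≡p)

    w : Fin t → Fin (suc k) → Carrier
    w l i = proj₁ (normalized-solution l i (i Finₚ.≟ p l))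

    w-pivot : ∀ l → w l (p l) ≈ 1#
    w-pivot l = proj₂ (proj₂ (normalized-solution l (p l) (p l Finₚ.≟ p l))) ≡.refl

    lifted : ∃[ v ] gen v 1# × (∀ l i → v i ≡ w l i mod ⟪ y l ⟫)
             × (∀ B → (∀ l → ⟦ B ⟧ _) → ∀ i → v i ≡ e₁ i mod B)
    lifted = lift-unimodular (λ l → ⟪ y l ⟫) (λ l → proj₁ (idem l))
      (λ l → proj₁ (proj₂ (idem l))) (λ l → proj₂ (proj₂ (idem l))) w p w-pivot
      where idem = comax-idempotents (λ l → ⟪ y l ⟫) y-comax

    v : Fin (suc k) → Carrier
    v = proj₁ lifted

    v≡w : ∀ l i → v i ≡ w l i mod ⟪ y l ⟫
    v≡w = proj₁ (proj₂ (proj₂ lifted))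

    v∉ : ∀ i l → ¬ carrier (G l) (v i)
    v∉ i l v∈ = proj₁ (proj₁ (proj₂ (normalized-solution l i (i Finₚ.≟ p l)))) (mod-∈ ⌊ G l ⌋
      (mod-sym (mod-mono (λ x → ^suc⊆ ⌊ G l ⌋ (n l) x ∘ ⟪y⟫⊆ l x) (v≡w l i))) v∈)

    b : Fin (suc k) → Carrier
    b i = σ̂ i * v i

    b≡scaled-a : ∀ l i → b i ≡ scale l * a i mod ⌊ G l ⌋ ^ n l
    b≡scaled-a l i = mod-trans
      (mod-*ˡ (σ̂ i) (mod-mono (λ x → ^-anti ⌊ G l ⌋ (ℕₚ.n≤1+n (n l)) x ∘ ⟪y⟫⊆ l x) (v≡w l i)))
      (proj₂ (proj₁ (proj₂ (normalized-solution l i (i Finₚ.≟ p l)))))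

    -- Modulo each power of `G l` the row b is a multiple of a, so the cross products agree; `∏-∩`
    -- joins these congruences.
    same-class : ∀ i j → ⟦ ∏ G n ⟧ (a i * b j - a j * b i)
    same-class i j = ∏-∩ G n cop λ l → diff (cross l)
      where
      cross : ∀ l → a i * b j ≡ a j * b i mod ⌊ G l ⌋ ^ n l
      cross l = begin
        a i * b j              ≈⟨ mod-*ˡ (a i) (b≡scaled-a l j) ⟩
        a i * (scale l * a j)  ≈⟨ ≈⇒mod (x*yz≈z*yx (a i) (scale l) (a j)) ⟩
        a j * (scale l * a i)  ≈⟨ mod-*ˡ (a j) (b≡scaled-a l i) ⟨
        a j * b i              ∎
        where open ModReasoning (⌊ G l ⌋ ^ n l)

    -- The product of the `y l` lies in (b) and is also a unit modulo (b). For the latter, symmetry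
    -- of `Comax` turns "b at the pivot is a unit modulo `y l`" into "`y l` is a unit modulo that
    -- entry".
    b-unimodular : gen b 1#
    b-unimodular = comax⇒1∈ T ⟪ prod y ⟫ (⟪⟫⊆ T prod-y∈) (prod-unitMod T y y-unit)
      where
      T = genᴵ b
      prod-y∈ : ⟦ T ⟧ (prod y)
      prod-y∈ = common-multiple∈gen σ̂ v (proj₁ (proj₂ lifted))
        (λ i → prod-∣ (λ l → s l (e i l)) y (s∣y i))
      y-unit : ∀ l → UnitMod T (y l)
      y-unit l = unitMod-mono (⟪⟫⊆ T (gen-∈ b (p l)))
        (comax-sym ⟪ y l ⟫ ⟪ b (p l) ⟫ (unitMod-* ⟪ y l ⟫ (σ̂-pivot l)
          (unitMod-≡1 ⟪ y l ⟫ (mod-trans (v≡w l (p l)) (≈⇒mod (w-pivot l))))))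

    -- The sum contains the product with exponents n, since e ≤ n. It is comaximal with every `G l`,
    -- because the ideal at the pivot has exponent 0 there, and so with that product too. The ideals
    -- B i allow the products to be rewritten over F.
    exponents-comaximal : (B : Fin (suc k) → Ideal) → (∀ i → ⟦ ∏ G (e i) ⟧ ⊆ ⟦ B i ⟧) →
                          sumIdeals (⟦_⟧ ∘ B) ≐ whole
    exponents-comaximal B ⊆B = 1∈⇒whole T (comax⇒1∈ T (∏ G n) ∏Gn⊆T
      (comax-∏ T G n λ l → comax-^ T ⌊ G l ⌋ (n l) (comax-sym ⌊ G l ⌋ T (G-comax l))))
      where
      T = sumᴵ B
      ∏Ge⊆T : ∀ i → ⟦ ∏ G (e i) ⟧ ⊆ ⟦ T ⟧
      ∏Ge⊆T i x = ⊆sumᴵ B i x ∘ ⊆B i x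
      ∏Gn⊆T : ⟦ ∏ G n ⟧ ⊆ ⟦ T ⟧
      ∏Gn⊆T x = ∏Ge⊆T zero x ∘ ∏-anti G (e≤n zero) x
      G-comax : ∀ l → Comax ⌊ G l ⌋ T
      G-comax l = comax-monoʳ ⌊ G l ⌋ (∏ G (e (p l))) T (∏Ge⊆T (p l))
        (comax-∏ ⌊ G l ⌋ G (e (p l)) factor)
        where
        factor : ∀ l′ → Comax ⌊ G l ⌋ (⌊ G l′ ⌋ ^ e (p l) l′)
        factor l′ with l′ Finₚ.≟ l
        ... | no  l′≢l   = comax-^ ⌊ G l ⌋ ⌊ G l′ ⌋ (e (p l) l′) (cop l l′ (l′≢l ∘ ≡.sym))
        ... | yes ≡.refl = ≡.subst (λ d → Comax ⌊ G l ⌋ (⌊ G l ⌋ ^ d)) (≡.sym (e-pivot l))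
                             (comax-whole ⌊ G l ⌋)

  -- Consequences of the conditions on Σ.

  comax-split : ∀ A B → Comax A B → ∀ x →
    Σ (Fin 2 → Carrier) λ a → ⟦ A ⟧ (a zero) × ⟦ B ⟧ (a (suc zero)) × x ≈ sumF a
  comax-split A B (q , q∈B , q≡1) x = (x * (1# - q) ∷ λ _ → x * q)
    , Ideal.*-clos A x (diff (mod-sym q≡1)) , Ideal.*-clos B x q∈B
    , sym (begin
      x * (1# - q) + (x * q + 0#)  ≈⟨ +-congˡ (+-identityʳ (x * q)) ⟩
      x * (1# - q) + x * q         ≈⟨ distribˡ x (1# - q) q ⟨
      x * ((1# - q) + q)           ≈⟨ *-congˡ (+-assoc 1# (- q) q) ⟩
      x * (1# + (- q + q))         ≈⟨ *-congˡ (+-congˡ (-‿inverseˡ q)) ⟩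
      x * (1# + 0#)                ≈⟨ *-congˡ (+-identityʳ 1#) ⟩
      x * 1#                       ≈⟨ *-identityʳ x ⟩
      x                            ∎)
    where open SetoidReasoning setoid

  comax-cong : ∀ {A A′ B B′} → A ≃ A′ → B ≃ B′ → Comax A′ B′ → Comax A B
  comax-cong (mk≃ _ A′⊆A) (mk≃ _ B′⊆B) (q , q∈ , e) = q , B′⊆B q q∈ , mod-mono A′⊆A e

  module Σ-Properties {m} (F : Fin m → MaxIdeal) {σ : Exps m → Carrier} (isΣ : IsSigma F σ) where

    open IsSigma isΣ

    -- Condition (4) for two ideals writes 1 as a combination of both values; modulo the first only
    -- the second term remains.
    σ-coprime : ∀ d d′ → Comax (∏ F d) (∏ F d′) → UnitMod ⟪ σ d ⟫ (σ d′)
    σ-coprime d d′ h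
      with proj₂ (cond4 2 (d ∷ λ _ → d′)
             ((λ _ _ → tt) , λ x _ → let a , a₀∈ , a₁∈ , x≈ = comax-split (∏ F d) (∏ F d′) h x in
               a , (λ { zero → a₀∈ ; (suc zero) → a₁∈ }) , x≈)) 1# tt
    ... | r , 1≈ = unitMod-intro ⟪ σ d ⟫ (r (suc zero)) (mod-sym (begin
      1#                         ≈⟨ ≈⇒mod 1≈ ⟩
      r₀σd + (r₁σd′ + 0#)        ≈⟨ mod-+ (∈⇒mod0 (r zero , refl)) (≈⇒mod (+-identityʳ r₁σd′)) ⟩
      0# + r₁σd′                 ≈⟨ ≈⇒mod (+-identityˡ r₁σd′) ⟩
      r₁σd′                      ∎))
      where
      open ModReasoning ⟪ σ d ⟫
      r₀σd = r zero * σ d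
      r₁σd′ = r (suc zero) * σ d′

    σ-single : Fin m → ℕ → Carrier
    σ-single j d = σ (single j d)

    σ-single-∈ : ∀ j d → ⟦ ⌊ F j ⌋ ^ d ⟧ (σ-single j d)
    σ-single-∈ j d = ⊆-to (∏-single F j d) _ (proj₁ (cond2 (single j d)))

    σ-single-∉ : ∀ j d → ¬ ⟦ ⌊ F j ⌋ ^ suc d ⟧ (σ-single j d)
    -- Condition (2) with K = `F j`: membership in the next power would put the value in J K.
    σ-single-∉ j d σ∈ = proj₂ (cond2 (single j d)) (single j 1) proper (⊆-to eq _ σ∈)
      where
      A = ⌊ F j ⌋
      proper : ¬ (prodF F (single j 1) ≐ whole)
      proper (_ , g) = IsMaximal.proper (MaxIdeal.isMaximal (F j))
        (⊆-to (𝕀.trans (∏-single F j 1) (^1≃ A)) 1# (g 1# tt))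
      eq : A ⊗ A ^ d ≃ ∏ F (single j d) ⊗ ∏ F (single j 1)
      eq = 𝕀.trans (𝕀.comm A (A ^ d))
        (𝕀.∙-cong (𝕀.sym (∏-single F j d)) (𝕀.sym (𝕀.trans (∏-single F j 1) (^1≃ A))))

    σ-single-0 : ∀ j → σ-single j 0 ≈ 1#
    σ-single-0 j =
      -- `single j 0` and `e₀` agree only pointwise, so the comparison goes through the ideals.
      trans (welldef _ _ (≃⇒≐ (𝕀.trans (∏-single F j 0) (𝕀.sym (∏-e₀ F))))) cond1

    -- The first power is comaximal with the product of the rest, so condition (3) splits it off.
    σ-push : ∀ {t} (f : Fin t → Fin m) →
             (∀ l l′ → l ≢ l′ → Comax ⌊ F (f l) ⌋ ⌊ F (f l′) ⌋) →
             ∀ d → σ (push f d) ≈ prod (λ l → σ-single (f l) (d l))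
    σ-push {zero}  f cop d = cond1
    σ-push {suc t} f cop d =
      trans (cond3 e₀′ e₁′ (push f d)
              ((λ _ _ → tt) , λ x _ → let a , a₀∈ , a₁∈ , x≈ = comax-split (∏ F e₀′) (∏ F e₁′) comax x in
                a , (λ { zero → a₀∈ ; (suc zero) → a₁∈ }) , x≈)
              (≃⇒≐ (𝕀.trans (∏-raise F (f zero) (d zero) e₁′)
                            (𝕀.∙-congʳ (𝕀.sym (∏-single F (f zero) (d zero)))))))
            (*-congˡ (σ-push (f ∘ suc) (λ l l′ l≢l′ → cop (suc l) (suc l′) (l≢l′ ∘ Finₚ.suc-injective))
              (d ∘ suc)))
      where
      e₀′ = single (f zero) (d zero)
      e₁′ = push (f ∘ suc) (d ∘ suc)
      A = ⌊ F (f zero) ⌋ ^ d zero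
      comax : Comax (∏ F e₀′) (∏ F e₁′)
      comax = comax-cong (∏-single F (f zero) (d zero)) (∏-push F (f ∘ suc) (d ∘ suc))
        (comax-∏ A (F ∘ f ∘ suc) (d ∘ suc) λ l →
          comax-^ A ⌊ F (f (suc l)) ⌋ (d (suc l))
            (comax-sym ⌊ F (f (suc l)) ⌋ A
              (comax-^ ⌊ F (f (suc l)) ⌋ ⌊ F (f zero) ⌋ (d zero) (cop (suc l) zero λ ()))))

  -- A maximal ideal of a field contains no nonzero element.
  nonfield-dim1 : IsDedekindType → ∀ M {z} → carrier M z → ¬ (z ≈ 0#) → ∀ i → Dim1 (carrier M) i
  nonfield-dim1 (inj₂ (h , _)) M z∈ z≉0 = proj₂ (proj₂ (h M))
  nonfield-dim1 (inj₁ (_ , inverse)) M {z} z∈ z≉0 with inverse z z≉0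
  ... | r , zr≈1 = ⊥-elim (IsMaximal.proper (MaxIdeal.isMaximal M)
                             (Ideal.resp ⌊ M ⌋ zr≈1 (*-closʳ ⌊ M ⌋ r z∈)))

-- Assembly of the representative over F.

mainTheorem11 : ∀ {c ℓ : Level} (R : CommutativeRing c ℓ) →
    let open CommutativeRing R
        open RingDefs R
    in IsDedekindType →
       ∀ (I : Subset) → InMR I →
       ∀ (k : ℕ) → k ≥ 2 →
       ∀ (m : ℕ) (F : Fin m → MaxIdeal) →
       (∀ (M : MaxIdeal) → I ⊆ carrier M → ∃[ j ] (carrier M ≐ carrier (F j))) →
       ∀ (σ : Exps m → Carrier) → IsSigma F σ →
       ∀ (a : Fin (suc k) → Carrier) → Unital a →
       Σ (Fin (suc k) → Exps m) λ J → Σ (Fin (suc k) → Carrier) λ v →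
         (∀ i → I ⊆ prodF F (J i))
         × (sumIdeals (λ i → prodF F (J i)) ≐ whole)
         × (∀ i j → v i ∉ carrier (F j))
         × Unital (λ i → σ (J i) * v i)
         × Rel I a (λ i → σ (J i) * v i)
mainTheorem11 R dedekind I (_ , L , I⊆L , L⊆I) k _ m F coversI σ isΣ a unital-a =
  J , v , I⊆J
  , exponents-comaximal (λ i → ∏ F (J i)) (λ i → ⊆-from (∏-push F f (e i)))
  -- Every member of F equals some `G l`, so avoiding the latter suffices.
  , (λ i j v∈ → let l , Fj⊆ , _ = cover j in v∉ i l (Fj⊆ (v i) v∈))
  , 1∈⇒whole T (gen-elim b T (λ i → Ideal.resp T (sym (b≈ i)) (gen-∈ b′ i)) 1# b-unimodular)
  , λ i j _ → L⊆I _ (⊆-from ⨂L≃∏G _ (Ideal.resp (∏ G n)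
      (+-cong (*-congˡ (b≈ j)) (-‿cong (*-congˡ (b≈ i)))) (same-class i j)))
  where
  open CommutativeRing R hiding (zero)
  open RingDefs R
  open Ideals R
  open _≃_
  open Σ-Properties F isΣ

  subfamily = comaximal-subfamily F
  f = proj₁ (proj₂ subfamily)
  cop = proj₁ (proj₂ (proj₂ subfamily))
  cover = proj₂ (proj₂ (proj₂ subfamily))
  G = F ∘ f

  -- A factor of I contains I, hence occurs in F and therefore in G.
  L-in-G : ∀ i → ∃[ l ] carrier (L i) ≐ carrier (G l)
  L-in-G i = let j , Li≐Fj = coversI (L i) (λ x x∈ → ⨂⊆ L i x (I⊆L x x∈))
                 l , Fj≐Gl = cover j
             in l , ≐-trans Li≐Fj Fj≐Gl

  exponents = ⨂-exponents L G L-in-G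
  n = proj₁ exponents
  ⨂L≃∏G = proj₂ exponents

  s-coprime : ∀ l l′ → l ≢ l′ → ∀ d d′ → UnitMod ⟪ σ-single (f l) d ⟫ (σ-single (f l′) d′)
  s-coprime l l′ l≢l′ d d′ = σ-coprime (single (f l) d) (single (f l′) d′)
    (comax-cong (∏-single F (f l) d) (∏-single F (f l′) d′)
      (comax-^ (⌊ G l ⌋ ^ d) ⌊ G l′ ⌋ d′ (comax-sym ⌊ G l′ ⌋ (⌊ G l ⌋ ^ d)
        (comax-^ ⌊ G l′ ⌋ ⌊ G l ⌋ d (cop l′ l (l≢l′ ∘ ≡.sym))))))

  -- Σ(`G l`) is a nonzero element of `G l`, which excludes the field case.
  dim : ∀ l i → Dim1 (carrier (G l)) i
  dim l = nonfield-dim1 dedekind (G l) (^suc⊆ ⌊ G l ⌋ 0 _ (σ-single-∈ (f l) 1))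
            (IsSigma.nowhereZero isΣ (single (f l) 1))

  open Representative G cop dim (λ l → σ-single (f l)) (λ l → σ-single-∈ (f l))
    (λ l → σ-single-∉ (f l)) (λ l → σ-single-0 (f l)) s-coprime n a (proj₂ unital-a 1# tt)

  J = λ i → push f (e i)

  b′ = λ i → σ (J i) * v i

  b≈ : ∀ i → b i ≈ b′ i
  b≈ i = *-congʳ (sym (σ-push f cop (e i)))

  T = genᴵ b′

  I⊆J : ∀ i → I ⊆ prodF F (J i)
  I⊆J i x x∈ = ⊆-from (∏-push F f (e i)) x
    (∏-anti G (e≤n i) x (⊆-to ⨂L≃∏G x (I⊆L x x∈)))
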